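{- Let $G$ be a connected nonbipartite graph with $n \geq 4$ vertices. Then $$Sz^*(G)-W(G) \geq \frac{n^2+4n-6}{4}.$$ Equality holds if and only if $G$ is composed of a cycle $C_3$ on $3$ vertices and a tree $T$ on $n-2$ vertices sharing a single vertex.
   Context: All graphs are finite, undirected and simple. For a connected graph $G$, $d_G(u,v)$ is the distance between $u$ and $v$ in $G$, and the Wiener index is $W(G)=\sum_{\{u,v\}\subseteq V(G)} d_G(u,v)$ (sum over unordered pairs of distinct vertices). For an edge $e=uv$ let $n_u(e)=|\{w\in V(G): d_G(u,w)<d_G(v,w)\}|$, $n_v(e)=|\{w\in V(G): d_G(v,w)<d_G(u,w)\}|$ and $n_0(e)=|\{w\in V(G): d_G(u,w)=d_G(v,w)\}|$. The revised Szeged index is $$Sz^*(G)=\sum_{e=uv\in E(G)}\left(n_u(e)+\frac{n_0(e)}{2}\right)\left(n_v(e)+\frac{n_0(e)}{2}\right).$$ "A cycle and a tree sharing a single vertex" means that $G$ is the union of the cycle and the tree, which have exactly one vertex (and no edge) in common. -}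

module Defs where

open import Data.Bool.Base using (Bool)
open import Data.Fin.Base using (Fin; toℕ)
open import Data.Fin.Properties using (_≟_; _<?_; any?)
open import Data.Integer.Base using (+_)
open import Data.List.Base using (List; allFin; cartesianProduct; filter; foldr; length; map)
open import Data.Nat.Base using (ℕ; zero; suc; _≤_; _∸_; z≤n; s≤s)
import Data.Nat.Properties as ℕ
open import Data.Nat.ListAction using (sum)
open import Data.Product.Base using (Σ; ∃; _×_; _,_; proj₁; proj₂)
open import Data.Product using (∃!)
open import Data.Rational.Base using (ℚ; 0ℚ; _+_; _*_; _/_)
open import Data.Sum.Base using (_⊎_; inj₁; inj₂; swap)
open import Function.Base using (_∘_)
open import Function.Bundles using (_⇔_)
open import Function.Definitions using (Injective)
open import Level using (0ℓ)
open import Relation.Binary.Core using (Rel)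
open import Relation.Binary.Definitions using (Decidable; Irreflexive; Symmetric)
open import Relation.Binary.PropositionalEquality using (_≡_; _≢_; refl)
open import Relation.Nullary.Decidable.Core using (Dec; yes; no; map′; _×-dec_; _⊎-dec_)
open import Relation.Nullary.Negation.Core using (¬_; contradiction)

record Graph (n : ℕ) : Set₁ where
  field
    Adj    : Rel (Fin n) 0ℓ
    adj?   : Decidable Adj
    sym    : Symmetric Adj
    irrefl : Irreflexive _≡_ Adj

open Graph public using (Adj; adj?)

data Walk {n} (G : Graph n) : Fin n → Fin n → ℕ → Set where
  []  : ∀ {u} → Walk G u u zero
  _∷_ : ∀ {u v w k} → Adj G u v → Walk G v w k → Walk G u w (suc k)

Connected : ∀ {n} → Graph n → Set
Connected G = ∀ u v → ∃ (Walk G u v)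

Bipartite : ∀ {n} → Graph n → Set
Bipartite {n} G = Σ (Fin n → Bool) λ c → ∀ {u v} → Adj G u v → c u ≢ c v

walk? : ∀ {n} (G : Graph n) u v k → Dec (Walk G u v k)
walk? G u v zero    = map′ (λ { refl → [] }) (λ { [] → refl }) (u ≟ v)
walk? G u v (suc k) =
  map′ (λ { (_ , a , p) → a ∷ p }) (λ { (a ∷ p) → _ , a , p })
       (any? λ w → adj? G u w ×-dec walk? G w v k)

Least : (ℕ → Set) → ℕ → Set
Least P d = P d × (∀ j → P j → d ≤ j)

least : ∀ {P : ℕ → Set} → (∀ k → Dec (P k)) → ∃ P → ∃ (Least P)
least P? (k , p) = go P? k p
  where
  go : ∀ {P : ℕ → Set} → (∀ k → Dec (P k)) → ∀ k → P k → ∃ (Least P)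
  go P? zero    p = zero , p , λ _ _ → z≤n
  go P? (suc k) p with P? zero
  ... | yes p₀ = zero , p₀ , λ _ _ → z≤n
  ... | no ¬p₀ with go (P? ∘ suc) k p
  ...   | d , q , min = suc d , q , λ where
            zero    r → contradiction r ¬p₀
            (suc j) r → s≤s (min j r)

-- The parameter only supplies existence of a walk; the value of dist does not
-- depend on which proof of connectedness is given.
module _ {n} {G : Graph n} (conn : Connected G) where

  shortest : ∀ u v → ∃ (Least (Walk G u v))
  shortest u v = least (walk? G u v) (conn u v)

  dist : Fin n → Fin n → ℕ
  dist u v = proj₁ (shortest u v)

-- Each unordered pair of distinct vertices occurs once, smaller vertex first.
pairs : ∀ n → List (Fin n × Fin n)
pairs n = filter (λ (u , v) → u <? v) (cartesianProduct (allFin n) (allFin n))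

edges : ∀ {n} → Graph n → List (Fin n × Fin n)
edges {n} G = filter (λ (u , v) → adj? G u v) (pairs n)

sumℚ : List ℚ → ℚ
sumℚ = foldr _+_ 0ℚ

module _ {n} {G : Graph n} (conn : Connected G) where

  wiener : ℕ
  wiener = sum (map (λ (u , v) → dist conn u v) (pairs n))

  closer : Fin n → Fin n → ℕ
  closer u v = length (filter (λ w → dist conn u w ℕ.<? dist conn v w) (allFin n))

  equidistant : Fin n → Fin n → ℕ
  equidistant u v = length (filter (λ w → dist conn u w ℕ.≟ dist conn v w) (allFin n))

  revisedSzeged : ℚ
  revisedSzeged = sumℚ (map term (edges G))
    where
    term : Fin n × Fin n → ℚ
    term (u , v) = (+ closer u v / 1 + + equidistant u v / 2)
                 * (+ closer v u / 1 + + equidistant u v / 2)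

-- Successor modulo k.
Next : ∀ {k} → Rel (Fin k) 0ℓ
Next {k} i j = toℕ j ≡ suc (toℕ i) ⊎ (suc (toℕ i) ≡ k × toℕ j ≡ 0)

cycle : ∀ k → 3 ≤ k → Graph k
cycle k 3≤k = record
  { Adj    = λ i j → Next i j ⊎ Next j i
  ; adj?   = λ i j → next? i j ⊎-dec next? j i
  ; sym    = swap
  ; irrefl = λ { refl (inj₁ p) → ¬loop 3≤k p ; refl (inj₂ p) → ¬loop 3≤k p }
  }
  where
  open import Relation.Binary.PropositionalEquality using (sym)

  next? : Decidable (Next {k})
  next? i j = (toℕ j ℕ.≟ suc (toℕ i)) ⊎-dec ((suc (toℕ i) ℕ.≟ k) ×-dec (toℕ j ℕ.≟ 0))

  ¬loop : ∀ {m} → 3 ≤ m → {i : Fin m} → ¬ Next i i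
  ¬loop _               {i}     (inj₁ e)        = ℕ.1+n≢n (sym e)
  ¬loop (s≤s (s≤s _))   {Fin.zero}  (inj₂ (() , _))
  ¬loop _               {Fin.suc i} (inj₂ (_ , ()))

C₃ : Graph 3
C₃ = cycle 3 ℕ.≤-refl

-- H is isomorphic to a (not necessarily induced) subgraph of G.
Contains : ∀ {n k} → Graph n → Graph k → Set
Contains {n} {k} G H = Σ (Fin k → Fin n) λ f →
  Injective _≡_ _≡_ f × (∀ {i j} → Adj H i j → Adj G (f i) (f j))

Acyclic : ∀ {n} → Graph n → Set
Acyclic G = ∀ k (3≤k : 3 ≤ k) → ¬ Contains G (cycle k 3≤k)

IsTree : ∀ {n} → Graph n → Set
IsTree G = Connected G × Acyclic G

-- Adjacency of the copy of H on the image of f.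
ImageAdj : ∀ {n k} → Graph k → (Fin k → Fin n) → Rel (Fin n) 0ℓ
ImageAdj H f u v = ∃ λ i → ∃ λ j → f i ≡ u × f j ≡ v × Adj H i j

-- G is the union of a copy of H and a copy of K having exactly one vertex in
-- common. The copies then have no common edge, since an edge has two distinct
-- endpoints.
record IsUnionSharingVertex {n p q} (G : Graph n) (H : Graph p) (K : Graph q) : Set where
  field
    f           : Fin p → Fin n
    g           : Fin q → Fin n
    f-injective : Injective _≡_ _≡_ f
    g-injective : Injective _≡_ _≡_ g
    vertices    : ∀ v → (∃ λ i → f i ≡ v) ⊎ (∃ λ j → g j ≡ v)
    shared      : ∃! _≡_ λ v → (∃ λ i → f i ≡ v) × (∃ λ j → g j ≡ v)
    adjacency   : ∀ u v → Adj G u v ⇔ (ImageAdj H f u v ⊎ ImageAdj K g u v)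

-- Truncated subtraction is subtraction for n ≥ 2.
IsTriangleWithTree : ∀ {n} → Graph n → Set₁
IsTriangleWithTree {n} G = Σ (Graph (n ∸ 2)) λ T → IsTree T × IsUnionSharingVertex G C₃ T

{-# OPTIONS --safe #-}

-- Call an edge horizontal for x when its ends are equidistant from x. Expanding each
-- product of Sz* as a double sum over vertices gives 4 Sz* = Σ (2 s(x,y) + z(x,y)) over
-- all ordered pairs (x,y), including x = y, where s counts the edges separating x
-- strictly from y and z counts the edges horizontal for x or for y, while 2 W = Σ
-- d(x,y). A geodesic shows s ≥ d, an odd cycle shows z ≥ 1, and z − 1 satisfies the
-- triangle inequality. Choose an edge uv horizontal for some x with d(u,x) minimal: then
-- z ≥ 2 between any two of x, u, v, so every vertex has total excess δ = 2 s + z − 2 d −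
-- 1 at least 2 towards {x,u,v}, and summing over all ordered pairs gives Σ δ ≥ 2 n + 2
-- (n − 3) = 4 n − 6.
--
-- In the case of equality s = d, each vertex has a single horizontal edge, and
-- minimality forces xuv to be a triangle two of whose vertices have degree 2; deleting
-- these leaves no cycle, because an edge of a cycle would not be the only edge
-- separating its ends. Conversely, the edges of the tree are bridges, for which both
-- counts are explicit.

module Submission where

open import Defs
open import Algebra.Properties.CommutativeSemigroup using (interchange)
open import Data.Bool.Base using (Bool; false; not)
open import Data.Bool.Properties using (not-¬)
open import Data.Empty using (⊥-elim)
open import Data.Fin.Base using (Fin; zero; suc; toℕ; fromℕ; inject₁; punchIn; punchOut)
open import Data.Fin.Induction using (<-weakInduction)
import Data.Fin.Base as Fin
import Data.Fin.Properties as Fin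
open import Data.Integer.Base using (+_)
import Data.Integer.Base as ℤ
import Data.Integer.Properties as ℤ
import Data.Integer.Solver as ℤ-Solver
open import Data.List.Base using (List; []; _∷_; _++_; allFin; cartesianProduct; filter; length; map; upTo)
open import Data.List.Membership.Propositional using (_∈_)
open import Data.List.Membership.Propositional.Properties
  using (∈-∃++; ∈-allFin; ∈-cartesianProduct⁺; ∈-filter⁺; ∈-filter⁻; ∈-upTo⁻)
open import Data.List.Properties using (length-tabulate; length-upTo; map-++; map-∘)
open import Data.List.Relation.Binary.Permutation.Propositional using (_↭_; ↭-prep; ↭-trans; ↭⇒↭ₛ)
open import Data.List.Relation.Binary.Permutation.Propositional.Properties using (map⁺; shift; ∈-resp-↭; ↭-length)
open import Data.List.Relation.Binary.Permutation.Setoid.Properties using (Unique-resp-↭)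
open import Data.List.Relation.Unary.All using (_∷_) renaming (lookup to lookupAll)
open import Data.List.Relation.Unary.AllPairs using ([]; _∷_)
open import Data.List.Relation.Unary.Any using (here; there)
open import Data.List.Relation.Unary.Unique.Propositional using (Unique)
import Data.List.Relation.Unary.Unique.Propositional.Properties as Unique
open import Data.Nat.Base hiding (_/_; _≥_)
import Data.Nat.Base as ℕ
open import Data.Nat.ListAction using (sum)
open import Data.Nat.ListAction.Properties using (sum-++; sum-↭)
open import Data.Nat.Properties
import Data.Nat.Solver as ℕ-Solver
open import Data.Product.Base using (∃; ∃₂; _×_; _,_; proj₁; proj₂)
open import Data.Product.Properties using (≡-dec)
open import Data.Rational.Base using (ℚ; _/_; _-_; _≥_; fromℚᵘ)
import Data.Rational.Base as ℚ
import Data.Rational.Properties as ℚ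
open import Data.Rational.Unnormalised.Base using (mkℚᵘ; *≡*; *≤*)
import Data.Rational.Unnormalised.Base as ℚᵘ
import Data.Rational.Unnormalised.Properties as ℚᵘ
open import Data.Sum.Base as Sum using (_⊎_; inj₁; inj₂)
open import Function.Base using (_∘_; id; case_of_)
open import Function.Bundles using (_⇔_; mk⇔; module Equivalence)
open import Function.Definitions using (Injective)
open import Level using (Level)
open import Relation.Binary.Definitions using (tri<; tri≈; tri>)
open import Relation.Binary.PropositionalEquality
open import Relation.Nullary.Decidable.Core using (Dec; yes; no; _×-dec_; ¬?)
open import Relation.Nullary.Negation.Core using (¬_; contradiction)
open import Relation.Unary using (Pred; Decidable)

-- Since 2 s + z = 1 + 2 d + δ, summing over ordered pairs gives 4 Sz* = n² + 4 W + Σ δ, so the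
-- claim is exactly Σ δ ≥ 4 n - 6.
--
-- Write H(x) for the set of edges horizontal for x. Then z(x,y) = |H(x) ∪ H(y)|, and the triangle
-- inequality for z - 1 is submodularity, |A ∪ C| + |B| ≤ |A ∪ B| + |B ∪ C|, together with |B| ≥ 1.
-- As z - 1 ≤ δ, a pair with z ≥ 2 cannot have excess 0 towards one and the same vertex at both
-- members.
--
-- Minimality enters through the first step of a geodesic from x to u: unless its end is as far from
-- v as x is, that end is the apex of a smaller configuration. So this step is horizontal for v, the
-- first step towards v is horizontal for u, and uv is horizontal for x. These edges differ because
-- no edge is horizontal for its own end.
--
-- For the converse, s ≤ d is an induction along a geodesic: a step towards x can lose no separating
-- edge except the one stepped along. The vertices fall into the classes {a}, {b} and the rest
-- according to their horizontal edge, with excess 0 within a class and at most 1 across classes.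

private variable
  ℓ₁ ℓ₂ ℓ₃ : Level
  A : Set ℓ₁
  B : Set ℓ₂

-- Sums over lists

∑ : List A → (A → ℕ) → ℕ
∑ xs f = sum (map f xs)

infixr 7 ∑
syntax ∑ xs (λ x → e) = ∑[ x ∈ xs ] e

∑-cong : {f g : A → ℕ} (xs : List A) → (∀ x → f x ≡ g x) → ∑ xs f ≡ ∑ xs g
∑-cong []       eq = refl
∑-cong (x ∷ xs) eq = cong₂ _+_ (eq x) (∑-cong xs eq)

∑-mono : {f g : A → ℕ} (xs : List A) → (∀ {x} → x ∈ xs → f x ≤ g x) → ∑ xs f ≤ ∑ xs g
∑-mono []       le = z≤n
∑-mono (x ∷ xs) le = +-mono-≤ (le (here refl)) (∑-mono xs (le ∘ there))

∑-+ : (xs : List A) (f g : A → ℕ) → ∑[ x ∈ xs ] (f x + g x) ≡ ∑ xs f + ∑ xs g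
∑-+ []       f g = refl
∑-+ (x ∷ xs) f g =
  trans (cong (_+_ (f x + g x)) (∑-+ xs f g)) (interchange +-commutativeSemigroup (f x) (g x) (∑ xs f) (∑ xs g))

∑-*ˡ : (c : ℕ) (xs : List A) (f : A → ℕ) → ∑[ x ∈ xs ] (c * f x) ≡ c * ∑ xs f
∑-*ˡ c []       f = sym (*-zeroʳ c)
∑-*ˡ c (x ∷ xs) f = trans (cong (_+_ (c * f x)) (∑-*ˡ c xs f)) (sym (*-distribˡ-+ c (f x) (∑ xs f)))

∑-*ʳ : (c : ℕ) (xs : List A) (f : A → ℕ) → ∑[ x ∈ xs ] (f x * c) ≡ ∑ xs f * c
∑-*ʳ c []       f = refl
∑-*ʳ c (x ∷ xs) f = trans (cong (_+_ (f x * c)) (∑-*ʳ c xs f)) (sym (*-distribʳ-+ c (f x) (∑ xs f)))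

∑-const : (c : ℕ) (xs : List A) → ∑[ _ ∈ xs ] c ≡ length xs * c
∑-const c []       = refl
∑-const c (_ ∷ xs) = cong (_+_ c) (∑-const c xs)

∑-swap : (xs : List A) (ys : List B) (f : A → B → ℕ) →
         ∑[ x ∈ xs ] ∑[ y ∈ ys ] f x y ≡ ∑[ y ∈ ys ] ∑[ x ∈ xs ] f x y
∑-swap []       ys f = sym (trans (∑-const 0 ys) (*-zeroʳ (length ys)))
∑-swap (x ∷ xs) ys f =
  trans (cong (_+_ (∑ ys (f x))) (∑-swap xs ys f)) (sym (∑-+ ys (f x) (λ y → ∑[ x′ ∈ xs ] f x′ y)))

∑-prod : (xs : List A) (ys : List B) (f : A → ℕ) (g : B → ℕ) →
         ∑ xs f * ∑ ys g ≡ ∑[ x ∈ xs ] ∑[ y ∈ ys ] (f x * g y)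
∑-prod xs ys f g = sym (trans (∑-cong xs λ x → ∑-*ˡ (f x) ys g) (∑-*ʳ (∑ ys g) xs f))

∑-↭ : {xs ys : List A} (f : A → ℕ) → xs ↭ ys → ∑ xs f ≡ ∑ ys f
∑-↭ f = sum-↭ ∘ map⁺ f

∑-++ : (xs ys : List A) (f : A → ℕ) → ∑ (xs ++ ys) f ≡ ∑ xs f + ∑ ys f
∑-++ xs ys f = trans (cong sum (map-++ f xs ys)) (sum-++ (map f xs) (map f ys))

∑-cartesianProduct : (xs : List A) (ys : List B) (f : A × B → ℕ) →
                     ∑ (cartesianProduct xs ys) f ≡ ∑[ x ∈ xs ] ∑[ y ∈ ys ] f (x , y)
∑-cartesianProduct []       ys f = refl
∑-cartesianProduct (x ∷ xs) ys f =
  trans (∑-++ (map (x ,_) ys) _ f)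
        (cong₂ _+_ (cong sum (sym (map-∘ ys))) (∑-cartesianProduct xs ys f))

⟦_⟧ : {P : Set ℓ₃} → Dec P → ℕ
⟦ yes _ ⟧ = 1
⟦ no _ ⟧  = 0

⟦⟧-yes : {P : Set ℓ₃} (d : Dec P) → P → ⟦ d ⟧ ≡ 1
⟦⟧-yes (yes _) _  = refl
⟦⟧-yes (no ¬p) p  = contradiction p ¬p

⟦⟧-no : {P : Set ℓ₃} (d : Dec P) → ¬ P → ⟦ d ⟧ ≡ 0
⟦⟧-no (yes p) ¬p = contradiction p ¬p
⟦⟧-no (no _)  _  = refl

module _ {P : Pred A ℓ₃} (P? : Decidable P) where

  ∑-filter : (xs : List A) (f : A → ℕ) → ∑ (filter P? xs) f ≡ ∑[ x ∈ xs ] (⟦ P? x ⟧ * f x)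
  ∑-filter []       f = refl
  ∑-filter (x ∷ xs) f with P? x
  ... | yes _ = cong₂ _+_ (sym (+-identityʳ (f x))) (∑-filter xs f)
  ... | no  _ = ∑-filter xs f

  length-filter-∑ : (xs : List A) → length (filter P? xs) ≡ ∑[ x ∈ xs ] ⟦ P? x ⟧
  length-filter-∑ []       = refl
  length-filter-∑ (x ∷ xs) with P? x
  ... | yes _ = cong suc (length-filter-∑ xs)
  ... | no  _ = length-filter-∑ xs

∈⇒≤∑ : {xs : List A} {x : A} (f : A → ℕ) → x ∈ xs → f x ≤ ∑ xs f
∈⇒≤∑ f (here refl) = m≤m+n _ _
∈⇒≤∑ f (there x∈)  = ≤-trans (∈⇒≤∑ f x∈) (m≤n+m _ _)

∈×∈⇒+≤∑ : {xs : List A} {x y : A} (f : A → ℕ) → x ∈ xs → y ∈ xs → x ≢ y → f x + f y ≤ ∑ xs f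
∈×∈⇒+≤∑         f (here refl) (here refl) x≢y = contradiction refl x≢y
∈×∈⇒+≤∑         f (here refl) (there y∈)  x≢y = +-monoʳ-≤ _ (∈⇒≤∑ f y∈)
∈×∈⇒+≤∑ {y = y} f (there x∈)  (here refl) x≢y =
  ≤-trans (≤-reflexive (+-comm _ (f y))) (+-monoʳ-≤ (f y) (∈⇒≤∑ f x∈))
∈×∈⇒+≤∑         f (there x∈)  (there y∈)  x≢y = ≤-trans (∈×∈⇒+≤∑ f x∈ y∈ x≢y) (m≤n+m _ _)

∑-zero : (xs : List A) {f : A → ℕ} → (∀ {x} → x ∈ xs → f x ≡ 0) → ∑ xs f ≡ 0
∑-zero []       eq = refl
∑-zero (x ∷ xs) eq = cong₂ _+_ (eq (here refl)) (∑-zero xs (eq ∘ there))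

-- Upper bounds such as z ≤ 1 take this shape: an indicator that can be nonzero at one prescribed
-- element only, and a list that contains it at most once.
∑-Unique≤1 : {xs : List A} (f : A → ℕ) (x₀ : A) → Unique xs →
             (∀ x → f x ≤ 1) → (∀ {x} → x ∈ xs → 1 ≤ f x → x ≡ x₀) → ∑ xs f ≤ 1
∑-Unique≤1 {xs = []}     f x₀ []         f≤1 only = z≤n
∑-Unique≤1 {xs = x ∷ xs} f x₀ (x∉ ∷ uxs) f≤1 only with f x in eq
... | zero  = ∑-Unique≤1 f x₀ uxs f≤1 (only ∘ there)
... | suc k = +-mono-≤ (subst (_≤ 1) eq (f≤1 x)) (≤-reflexive (∑-zero xs rest))
  where
  x≡x₀ : x ≡ x₀
  x≡x₀ = only (here refl) (subst (1 ≤_) (sym eq) (s≤s z≤n))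

  rest : ∀ {y} → y ∈ xs → f y ≡ 0
  rest {y} y∈ with f y in eqy
  ... | zero  = refl
  ... | suc _ = contradiction
    (trans x≡x₀ (sym (only (there y∈) (subst (1 ≤_) (sym eqy) (s≤s z≤n)))))
    (lookupAll x∉ y∈)

length*≤∑ : (c : ℕ) (xs : List A) (f : A → ℕ) → (∀ {x} → x ∈ xs → c ≤ f x) → length xs * c ≤ ∑ xs f
length*≤∑ c xs f c≤f = ≤-trans (≤-reflexive (sym (∑-const c xs))) (∑-mono xs c≤f)

∑≤length* : (c : ℕ) (xs : List A) (f : A → ℕ) → (∀ {x} → x ∈ xs → f x ≤ c) → ∑ xs f ≤ length xs * c
∑≤length* c xs f f≤c = ≤-trans (∑-mono xs f≤c) (≤-reflexive (∑-const c xs))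

-- The other terms use up at least `c` each of the total, which leaves at most `c` for this one.
∑-tight : (c : ℕ) (xs : List A) (f : A → ℕ) → (∀ {x} → x ∈ xs → c ≤ f x) →
          ∑ xs f ≤ length xs * c → ∀ {x} → x ∈ xs → f x ≤ c
∑-tight c (x ∷ xs) f c≤f le (here refl) =
  +-cancelʳ-≤ _ _ _ (≤-trans (+-monoʳ-≤ (f x) (length*≤∑ c xs f (c≤f ∘ there))) le)
∑-tight c (x ∷ xs) f c≤f le (there x∈) =
  ∑-tight c xs f (c≤f ∘ there) (+-cancelˡ-≤ c _ _ (≤-trans (+-monoˡ-≤ _ (c≤f (here refl))) le)) x∈

∈⇒↭∷ : {xs : List A} {x : A} → x ∈ xs → ∃ λ ys → xs ↭ x ∷ ys
∈⇒↭∷ {x = x} x∈ with ∈-∃++ x∈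
... | ys , zs , refl = ys ++ zs , shift x ys zs

∈-drop : {xs : List A} {x y : A} → x ≢ y → x ∈ y ∷ xs → x ∈ xs
∈-drop x≢y (here eq)  = contradiction eq x≢y
∈-drop x≢y (there x∈) = x∈

allFin↭∷∷∷ : ∀ {n} {x y z : Fin n} → x ≢ y → y ≢ z → x ≢ z → ∃ λ ws → allFin n ↭ x ∷ y ∷ z ∷ ws
allFin↭∷∷∷ {n} {x} {y} {z} x≢y y≢z x≢z =
  let us , p = ∈⇒↭∷ (∈-allFin x)
      vs , q = ∈⇒↭∷ (∈-drop (x≢y ∘ sym) (∈-resp-↭ p (∈-allFin y)))
      ws , r = ∈⇒↭∷ (∈-drop (y≢z ∘ sym) (∈-resp-↭ q (∈-drop (x≢z ∘ sym) (∈-resp-↭ p (∈-allFin z)))))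
  in ws , ↭-trans p (↭-prep x (↭-trans q (↭-prep y r)))

-- Walks

adj-sym : ∀ {n} (G : Graph n) {u v} → Adj G u v → Adj G v u
adj-sym G = Graph.sym G

adj⇒≢ : ∀ {n} (G : Graph n) {u v} → Adj G u v → u ≢ v
adj⇒≢ G a u≡v = Graph.irrefl G u≡v a

module _ {n} {G : Graph n} where

  infixr 5 _++ʷ_

  _++ʷ_ : ∀ {u v w k l} → Walk G u v k → Walk G v w l → Walk G u w (k + l)
  []      ++ʷ q = q
  (a ∷ p) ++ʷ q = a ∷ (p ++ʷ q)

  _∷ʳ_ : ∀ {u v w k} → Walk G u v k → Adj G v w → Walk G u w (suc k)
  []      ∷ʳ b = b ∷ []
  (a ∷ p) ∷ʳ b = a ∷ (p ∷ʳ b)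

  reverseʷ : ∀ {u v k} → Walk G u v k → Walk G v u k
  reverseʷ []      = []
  reverseʷ (a ∷ p) = reverseʷ p ∷ʳ adj-sym G a

  splitʷ : ∀ i {j u w} → Walk G u w (i + j) → ∃ λ v → Walk G u v i × Walk G v w j
  splitʷ zero    p       = _ , [] , p
  splitʷ (suc i) (a ∷ p) = let v , q , r = splitʷ i p in v , a ∷ q , r

-- The position of a vertex relative to an edge

-- Trichotomy of two distances as data, so that identities about a single edge become finite case
-- checks. `near` means closer to the first end.
data Side : Set where
  near mid far : Side

side : ℕ → ℕ → Side
side zero    zero    = mid
side zero    (suc _) = near
side (suc _) zero    = far
side (suc m) (suc k) = side m k

opp : Side → Side
opp near = far
opp mid  = mid
opp far  = near

side-opp : ∀ m k → side k m ≡ opp (side m k)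
side-opp zero    zero    = refl
side-opp zero    (suc k) = refl
side-opp (suc m) zero    = refl
side-opp (suc m) (suc k) = side-opp m k

side-< : ∀ {m k} → m < k → side m k ≡ near
side-< {zero}  {suc k} _         = refl
side-< {suc m} {suc k} (s≤s m<k) = side-< m<k

side-≡ : ∀ {m k} → m ≡ k → side m k ≡ mid
side-≡ {zero}  refl = refl
side-≡ {suc m} refl = side-≡ {m} refl

side-> : ∀ {m k} → k < m → side m k ≡ far
side-> {m} {k} k<m = trans (side-opp k m) (cong opp (side-< k<m))

near⇒< : ∀ {m k} → side m k ≡ near → m < k
near⇒< {zero}  {suc k} _  = s≤s z≤n
near⇒< {suc m} {suc k} eq = s≤s (near⇒< eq)

mid⇒≡ : ∀ {m k} → side m k ≡ mid → m ≡ k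
mid⇒≡ {zero}  {zero}  _  = refl
mid⇒≡ {suc m} {suc k} eq = cong suc (mid⇒≡ eq)

far⇒> : ∀ {m k} → side m k ≡ far → k < m
far⇒> {suc m} {zero}  _  = s≤s z≤n
far⇒> {suc m} {suc k} eq = s≤s (far⇒> {m} eq)

sep : Side → Side → ℕ
sep near far  = 1
sep far  near = 1
sep _    _    = 0

hor : Side → Side → ℕ
hor mid _   = 1
hor _   mid = 1
hor _   _   = 0

sep≤1 : ∀ a b → sep a b ≤ 1
sep≤1 near near = z≤n
sep≤1 near mid  = z≤n
sep≤1 near far  = ≤-refl
sep≤1 mid  _    = z≤n
sep≤1 far  near = ≤-refl
sep≤1 far  mid  = z≤n
sep≤1 far  far  = z≤n

hor≤1 : ∀ a b → hor a b ≤ 1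
hor≤1 near near = z≤n
hor≤1 near mid  = ≤-refl
hor≤1 near far  = z≤n
hor≤1 mid  _    = ≤-refl
hor≤1 far  near = z≤n
hor≤1 far  mid  = ≤-refl
hor≤1 far  far  = z≤n

sep-comm : ∀ a b → sep a b ≡ sep b a
sep-comm near near = refl
sep-comm near mid  = refl
sep-comm near far  = refl
sep-comm mid  near = refl
sep-comm mid  mid  = refl
sep-comm mid  far  = refl
sep-comm far  near = refl
sep-comm far  mid  = refl
sep-comm far  far  = refl

hor-comm : ∀ a b → hor a b ≡ hor b a
hor-comm near near = refl
hor-comm near mid  = refl
hor-comm near far  = refl
hor-comm mid  near = refl
hor-comm mid  mid  = refl
hor-comm mid  far  = refl
hor-comm far  near = refl
hor-comm far  mid  = refl
hor-comm far  far  = refl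

sep-opp : ∀ a b → sep (opp a) (opp b) ≡ sep a b
sep-opp near near = refl
sep-opp near mid  = refl
sep-opp near far  = refl
sep-opp mid  _    = refl
sep-opp far  near = refl
sep-opp far  mid  = refl
sep-opp far  far  = refl

hor-opp : ∀ a b → hor (opp a) (opp b) ≡ hor a b
hor-opp near near = refl
hor-opp near mid  = refl
hor-opp near far  = refl
hor-opp mid  _    = refl
hor-opp far  near = refl
hor-opp far  mid  = refl
hor-opp far  far  = refl

hor-midˡ : ∀ {a} b → a ≡ mid → hor a b ≡ 1
hor-midˡ b refl = refl

hor-midʳ : ∀ a {b} → b ≡ mid → hor a b ≡ 1
hor-midʳ a refl = hor-comm a mid

hor≥1⇒mid : ∀ a b → 1 ≤ hor a b → a ≡ mid ⊎ b ≡ mid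
hor≥1⇒mid near mid  _ = inj₂ refl
hor≥1⇒mid mid  _    _ = inj₁ refl
hor≥1⇒mid far  mid  _ = inj₂ refl

hor≤+ : ∀ a b → hor a b ≤ hor a a + hor b b
hor≤+ near near = z≤n
hor≤+ near mid  = ≤-refl
hor≤+ near far  = z≤n
hor≤+ mid  _    = s≤s z≤n
hor≤+ far  near = z≤n
hor≤+ far  mid  = ≤-refl
hor≤+ far  far  = z≤n

-- The share of one edge in |A ∪ C| + |B| ≤ |A ∪ B| + |B ∪ C|. If `b` is `mid`, both terms on the
-- right are 1; otherwise they are the indicators of `a` and of `c` being `mid`, and their sum
-- bounds that of the union.
hor-submodular : ∀ a b c → hor a c + hor b b ≤ hor a b + hor b c
hor-submodular near mid  c    = +-monoˡ-≤ 1 (hor≤1 near c)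
hor-submodular mid  mid  c    = ≤-refl
hor-submodular far  mid  c    = +-monoˡ-≤ 1 (hor≤1 far c)
hor-submodular mid  near c    = s≤s z≤n
hor-submodular mid  far  c    = s≤s z≤n
hor-submodular near near near = z≤n
hor-submodular near near mid  = ≤-refl
hor-submodular near near far  = z≤n
hor-submodular near far  near = z≤n
hor-submodular near far  mid  = ≤-refl
hor-submodular near far  far  = z≤n
hor-submodular far  near near = z≤n
hor-submodular far  near mid  = ≤-refl
hor-submodular far  near far  = z≤n
hor-submodular far  far  near = z≤n
hor-submodular far  far  mid  = ≤-refl
hor-submodular far  far  far  = z≤n

-- Unordered pairs and the edge list

module _ {n : ℕ} where

  -- Canonical form of an unordered pair: `edges` lists the smaller end first, while walks and
  -- adjacencies yield edges in either direction.
  ⟨_,_⟩ : Fin n → Fin n → Fin n × Fin n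
  ⟨ u , v ⟩ with u Fin.<? v
  ... | yes _ = u , v
  ... | no  _ = v , u

  ⟨⟩-cases : ∀ u v → (⟨ u , v ⟩ ≡ (u , v)) ⊎ (⟨ u , v ⟩ ≡ (v , u))
  ⟨⟩-cases u v with u Fin.<? v
  ... | yes _ = inj₁ refl
  ... | no  _ = inj₂ refl

  ⟨⟩-< : ∀ {u v} → u Fin.< v → ⟨ u , v ⟩ ≡ (u , v)
  ⟨⟩-< {u} {v} u<v with u Fin.<? v
  ... | yes _   = refl
  ... | no ¬u<v = contradiction u<v ¬u<v

  ⟨⟩-comm : ∀ {u v} → u ≢ v → ⟨ u , v ⟩ ≡ ⟨ v , u ⟩
  ⟨⟩-comm {u} {v} u≢v with u Fin.<? v | v Fin.<? u
  ... | yes p | yes q = contradiction q (Fin.<-asym p)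
  ... | yes _ | no  _ = refl
  ... | no  _ | yes _ = refl
  ... | no ¬p | no ¬q with Fin.<-cmp u v
  ...   | tri< p _ _ = contradiction p ¬p
  ...   | tri≈ _ e _ = contradiction e u≢v
  ...   | tri> _ _ q = contradiction q ¬q

  ⟨⟩-injective : ∀ {u v u′ v′} → ⟨ u , v ⟩ ≡ ⟨ u′ , v′ ⟩ → (u ≡ u′ × v ≡ v′) ⊎ (u ≡ v′ × v ≡ u′)
  ⟨⟩-injective {u} {v} {u′} {v′} eq with ⟨⟩-cases u v | ⟨⟩-cases u′ v′
  ... | inj₁ p | inj₁ q with trans (sym p) (trans eq q)
  ...   | refl = inj₁ (refl , refl)
  ⟨⟩-injective eq | inj₁ p | inj₂ q with trans (sym p) (trans eq q)
  ...   | refl = inj₂ (refl , refl)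
  ⟨⟩-injective eq | inj₂ p | inj₁ q with trans (sym p) (trans eq q)
  ...   | refl = inj₂ (refl , refl)
  ⟨⟩-injective eq | inj₂ p | inj₂ q with trans (sym p) (trans eq q)
  ...   | refl = inj₁ (refl , refl)

  ⟨⟩-cancelˡ : ∀ {u v w} → ⟨ u , v ⟩ ≡ ⟨ u , w ⟩ → v ≡ w
  ⟨⟩-cancelˡ eq with ⟨⟩-injective eq
  ... | inj₁ (_ , v≡w)   = v≡w
  ... | inj₂ (u≡w , v≡u) = trans v≡u u≡w

  _≟ₑ_ : (e f : Fin n × Fin n) → Dec (e ≡ f)
  _≟ₑ_ = ≡-dec Fin._≟_ Fin._≟_

  pairs-Unique : Unique (pairs n)
  pairs-Unique = Unique.filter⁺ _ (Unique.cartesianProduct⁺ (Unique.allFin⁺ n) (Unique.allFin⁺ n))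

  module _ (G : Graph n) where

    edges-Unique : Unique (edges G)
    edges-Unique = Unique.filter⁺ _ pairs-Unique

    ∈edges⁻ : ∀ {u v} → (u , v) ∈ edges G → Adj G u v × ⟨ u , v ⟩ ≡ (u , v)
    ∈edges⁻ e∈ =
      let e∈pairs , a = ∈-filter⁻ (λ (u , v) → adj? G u v) {xs = pairs n} e∈
          _ , u<v     = ∈-filter⁻ (λ (u , v) → u Fin.<? v) {xs = cartesianProduct (allFin n) (allFin n)} e∈pairs
      in a , ⟨⟩-< u<v

    <⇒∈edges : ∀ {u v} → u Fin.< v → Adj G u v → (u , v) ∈ edges G
    <⇒∈edges {u} {v} u<v a =
      ∈-filter⁺ _ (∈-filter⁺ _ (∈-cartesianProduct⁺ (∈-allFin u) (∈-allFin v)) u<v) a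

    ⟨⟩∈edges : ∀ {u v} → Adj G u v → ⟨ u , v ⟩ ∈ edges G
    ⟨⟩∈edges {u} {v} a with u Fin.<? v
    ... | yes u<v = <⇒∈edges u<v a
    ... | no ¬u<v with Fin.<-cmp u v
    ...   | tri< u<v _ _ = contradiction u<v ¬u<v
    ...   | tri≈ _ u≡v _ = contradiction u≡v (adj⇒≢ G a)
    ...   | tri> _ _ v<u = <⇒∈edges v<u (adj-sym G a)

isOdd : ℕ → Bool
isOdd zero    = false
isOdd (suc k) = not (isOdd k)

-- Separating and horizontal edges

-- The distance is a variable with its characterising property, so the arguments rest on shortest
-- walks and never on the search that computes `dist`.
module Metric {n} {G : Graph n} (d : Fin n → Fin n → ℕ)
              (geodesic : ∀ u v → Least (Walk G u v) (d u v)) where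

  walk : ∀ u v → Walk G u v (d u v)
  walk u v = proj₁ (geodesic u v)

  d-min : ∀ {u v k} → Walk G u v k → d u v ≤ k
  d-min {u} {v} p = proj₂ (geodesic u v) _ p

  d-sym : ∀ u v → d u v ≡ d v u
  d-sym u v = ≤-antisym (d-min (reverseʷ (walk v u))) (d-min (reverseʷ (walk u v)))

  d-refl : ∀ u → d u u ≡ 0
  d-refl u = n≤0⇒n≡0 (d-min [])

  d-triangle : ∀ u v w → d u w ≤ d u v + d v w
  d-triangle u v w = d-min (walk u v ++ʷ walk v w)

  d≡0⇒≡ : ∀ {u v} → d u v ≡ 0 → u ≡ v
  d≡0⇒≡ {u} {v} eq with d u v | walk u v
  d≡0⇒≡ refl | .0 | [] = refl

  d≡1⇒adj : ∀ {u v} → d u v ≡ 1 → Adj G u v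
  d≡1⇒adj {u} {v} eq with d u v | walk u v
  d≡1⇒adj refl | .1 | a ∷ [] = a

  adj⇒d≡1 : ∀ {u v} → Adj G u v → d u v ≡ 1
  adj⇒d≡1 {u} {v} a = ≤-antisym (d-min (a ∷ [])) (n≢0⇒n>0 (adj⇒≢ G a ∘ d≡0⇒≡))

  d-step : ∀ {u v} w → Adj G u v → d u w ≤ suc (d v w)
  d-step w a = d-min (a ∷ walk _ w)

  d-stepʳ : ∀ {u v} w → Adj G u v → d w u ≤ suc (d w v)
  d-stepʳ {u} {v} w a = subst₂ (λ m k → m ≤ suc k) (d-sym u w) (d-sym v w) (d-step w a)

  between : ∀ {u v} i j → d u v ≡ i + j → ∃ λ w → d u w ≡ i × d w v ≡ j
  between {u} {v} i j eq =
    let w , p , q = splitʷ i (subst (Walk G u v) eq (walk u v))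
        i+j≤      = ≤-trans (≤-reflexive (sym eq)) (d-triangle u w v)
    in w
     , ≤-antisym (d-min p) (+-cancelʳ-≤ j i _ (≤-trans i+j≤ (+-monoʳ-≤ _ (d-min q))))
     , ≤-antisym (d-min q) (+-cancelˡ-≤ i j _ (≤-trans i+j≤ (+-monoˡ-≤ _ (d-min p))))

  firstStep : ∀ {u v k} → d u v ≡ suc k → ∃ λ w → Adj G u w × d w v ≡ k
  firstStep {u} {v} {k} eq =
    let w , p , q = between 1 k eq in w , d≡1⇒adj p , q

  σ : Fin n × Fin n → Fin n → Side
  σ (u , v) w = side (d u w) (d v w)

  s z : Fin n → Fin n → ℕ
  s x y = ∑[ e ∈ edges G ] sep (σ e x) (σ e y)
  z x y = ∑[ e ∈ edges G ] hor (σ e x) (σ e y)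

  s-comm : ∀ x y → s x y ≡ s y x
  s-comm x y = ∑-cong (edges G) λ e → sep-comm (σ e x) (σ e y)

  z-comm : ∀ x y → z x y ≡ z y x
  z-comm x y = ∑-cong (edges G) λ e → hor-comm (σ e x) (σ e y)

  z≤+ : ∀ x y → z x y ≤ z x x + z y y
  z≤+ x y = ≤-trans (∑-mono (edges G) λ {e} _ → hor≤+ (σ e x) (σ e y))
                    (≤-reflexive (∑-+ (edges G) _ _))

  z-submodular : ∀ x y w → z x w + z y y ≤ z x y + z y w
  z-submodular x y w = subst₂ _≤_ (∑-+ (edges G) _ _) (∑-+ (edges G) _ _)
    (∑-mono (edges G) λ {e} _ → hor-submodular (σ e x) (σ e y) (σ e w))

  σ-opp : ∀ u v x → σ (v , u) x ≡ opp (σ (u , v) x)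
  σ-opp u v x = side-opp (d u x) (d v x)

  sep-⟨⟩ : ∀ u v x y → sep (σ ⟨ u , v ⟩ x) (σ ⟨ u , v ⟩ y) ≡ sep (σ (u , v) x) (σ (u , v) y)
  sep-⟨⟩ u v x y with ⟨⟩-cases u v
  ... | inj₁ eq rewrite eq = refl
  ... | inj₂ eq rewrite eq | σ-opp u v x | σ-opp u v y = sep-opp (σ (u , v) x) (σ (u , v) y)

  hor-⟨⟩ : ∀ u v x y → hor (σ ⟨ u , v ⟩ x) (σ ⟨ u , v ⟩ y) ≡ hor (σ (u , v) x) (σ (u , v) y)
  hor-⟨⟩ u v x y with ⟨⟩-cases u v
  ... | inj₁ eq rewrite eq = refl
  ... | inj₂ eq rewrite eq | σ-opp u v x | σ-opp u v y = hor-opp (σ (u , v) x) (σ (u , v) y)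

  Hor : Fin n → Fin n → Fin n → Set
  Hor u v x = d u x ≡ d v x

  Hor⇒hor : ∀ {u v} x y → Hor u v x ⊎ Hor u v y → hor (σ ⟨ u , v ⟩ x) (σ ⟨ u , v ⟩ y) ≡ 1
  Hor⇒hor {u} {v} x y (inj₁ h) = trans (hor-⟨⟩ u v x y) (hor-midˡ (σ (u , v) y) (side-≡ h))
  Hor⇒hor {u} {v} x y (inj₂ h) = trans (hor-⟨⟩ u v x y) (hor-midʳ (σ (u , v) x) (side-≡ h))

  Sep : Fin n → Fin n → Fin n → Fin n → Set
  Sep u v x y = d u x < d v x × d v y < d u y

  Sep⇒sep : ∀ {u v x y} → Sep u v x y → sep (σ ⟨ u , v ⟩ x) (σ ⟨ u , v ⟩ y) ≡ 1
  Sep⇒sep {u} {v} {x} {y} (p , q) =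
    trans (sep-⟨⟩ u v x y) (cong₂ sep (side-< p) (side-> {d u y} q))

  z≥2 : ∀ {u v u′ v′} x y → Adj G u v → Adj G u′ v′ → ⟨ u , v ⟩ ≢ ⟨ u′ , v′ ⟩ →
        Hor u v x ⊎ Hor u v y → Hor u′ v′ x ⊎ Hor u′ v′ y → 2 ≤ z x y
  z≥2 x y a a′ e≢e′ h h′ =
    subst₂ (λ m k → m + k ≤ z x y) (Hor⇒hor x y h) (Hor⇒hor x y h′)
           (∈×∈⇒+≤∑ _ (⟨⟩∈edges G a) (⟨⟩∈edges G a′) e≢e′)

  z≤1⇒≡ : ∀ {u v u′ v′} x y → z x y ≤ 1 → Adj G u v → Adj G u′ v′ →
          Hor u v x ⊎ Hor u v y → Hor u′ v′ x ⊎ Hor u′ v′ y → ⟨ u , v ⟩ ≡ ⟨ u′ , v′ ⟩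
  z≤1⇒≡ {u} {v} {u′} {v′} x y z≤1 a a′ h h′ with ⟨ u , v ⟩ ≟ₑ ⟨ u′ , v′ ⟩
  ... | yes e≡e′ = e≡e′
  ... | no  e≢e′ = contradiction (≤-trans (z≥2 x y a a′ e≢e′ h h′) z≤1) λ { (s≤s ()) }

  Hor-⟨⟩ : ∀ {u v u′ v′} x → ⟨ u , v ⟩ ≡ ⟨ u′ , v′ ⟩ → Hor u v x → Hor u′ v′ x
  Hor-⟨⟩ x eq h with ⟨⟩-injective eq
  ... | inj₁ (refl , refl) = h
  ... | inj₂ (refl , refl) = sym h

  s≥2 : ∀ {u v u′ v′ x y} → Adj G u v → Adj G u′ v′ → ⟨ u , v ⟩ ≢ ⟨ u′ , v′ ⟩ →
        Sep u v x y → Sep u′ v′ x y → 2 ≤ s x y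
  s≥2 {x = x} {y} a a′ e≢e′ p p′ =
    subst₂ (λ m k → m + k ≤ s x y) (Sep⇒sep p) (Sep⇒sep p′)
           (∈×∈⇒+≤∑ _ (⟨⟩∈edges G a) (⟨⟩∈edges G a′) e≢e′)

  -- For each i below d x y a geodesic has an edge whose nearer endpoint is at
  -- distance i from x; these d x y edges all separate x from y.
  d≤s : ∀ x y → d x y ≤ s x y
  d≤s x y = begin
    d x y                                                            ≡⟨ *-identityʳ _ ⟨
    d x y * 1                                                        ≡⟨ cong (_* 1) (length-upTo (d x y)) ⟨
    _                                                                ≤⟨ length*≤∑ 1 (upTo (d x y)) _ (hit ∘ ∈-upTo⁻) ⟩
    ∑[ i ∈ upTo (d x y) ] ∑[ e ∈ edges G ] (S e * ⟦ level e ≟ i ⟧)   ≡⟨ ∑-swap (edges G) (upTo (d x y)) _ ⟨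
    -- Double counting of pairs (i, e): every level i is hit by some separating edge, and every edge
    -- has a single level.
    ∑[ e ∈ edges G ] ∑[ i ∈ upTo (d x y) ] (S e * ⟦ level e ≟ i ⟧)   ≤⟨ ∑-mono (edges G) (λ {e} _ → once e) ⟩
    ∑[ e ∈ edges G ] (S e * 1)                                       ≡⟨ ∑-cong (edges G) (λ e → *-identityʳ (S e)) ⟩
    s x y                                                            ∎
    where
    open ≤-Reasoning

    S : Fin n × Fin n → ℕ
    S e = sep (σ e x) (σ e y)

    level : Fin n × Fin n → ℕ
    level (u , v) = d x u ⊓ d x v

    level-⟨⟩ : ∀ u v → level ⟨ u , v ⟩ ≡ d x u ⊓ d x v
    level-⟨⟩ u v with ⟨⟩-cases u v
    ... | inj₁ eq rewrite eq = refl
    ... | inj₂ eq rewrite eq = ⊓-comm (d x v) (d x u)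

    ⟦≟⟧≤1 : ∀ (m k : ℕ) → ⟦ m ≟ k ⟧ ≤ 1
    ⟦≟⟧≤1 m k with m ≟ k
    ... | yes _ = ≤-refl
    ... | no  _ = z≤n

    1≤⟦≟⟧ : ∀ (m k : ℕ) → 1 ≤ ⟦ m ≟ k ⟧ → k ≡ m
    1≤⟦≟⟧ m k le with m ≟ k
    ... | yes eq = sym eq

    once : ∀ e → ∑[ i ∈ upTo (d x y) ] (S e * ⟦ level e ≟ i ⟧) ≤ S e * 1
    once e = ≤-trans (≤-reflexive (∑-*ˡ (S e) (upTo (d x y)) _))
      (*-monoʳ-≤ (S e) (∑-Unique≤1 _ (level e) (Unique.upTo⁺ (d x y))
                          (⟦≟⟧≤1 (level e)) (λ {i} _ → 1≤⟦≟⟧ (level e) i)))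

    hit : ∀ {i} → i < d x y → 1 ≤ ∑[ e ∈ edges G ] (S e * ⟦ level e ≟ i ⟧)
    hit {i} i<d =
      let j , eq         = m<n⇒∃[j] i<d
          u , xu , uy    = between i (suc j) (trans eq (sym (+-suc i j)))
          v , a , vy     = firstStep uy
          xv≤ = ≤-trans (d-stepʳ x (adj-sym G a)) (≤-reflexive (cong suc xu))
          -- `v` is at distance at least i + 1 from `x`, since only j steps remain from `v` to `y`.
          xv≥ = +-cancelʳ-≤ j (suc i) (d x v)
                  (≤-trans (≤-reflexive (sym eq)) (≤-trans (d-triangle x v y) (≤-reflexive (cong (_+_ (d x v)) vy))))
          xv  = ≤-antisym xv≤ xv≥
          u<v = subst₂ _<_ (sym (trans (d-sym u x) xu)) (sym (trans (d-sym v x) xv)) ≤-refl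
          v<u = subst₂ _<_ (sym vy) (sym uy) ≤-refl
          lev = trans (level-⟨⟩ u v) (trans (cong₂ _⊓_ xu xv) (m≤n⇒m⊓n≡m (n≤1+n i)))
          val = cong₂ _*_ (Sep⇒sep (u<v , v<u)) (⟦⟧-yes (level ⟨ u , v ⟩ ≟ i) lev)
      in ≤-trans (≤-reflexive (sym val)) (∈⇒≤∑ (λ e → S e * ⟦ level e ≟ i ⟧) (⟨⟩∈edges G a))
      where
      m<n⇒∃[j] : ∀ {m k} → m < k → ∃ λ j → k ≡ suc m + j
      m<n⇒∃[j] {m} {k} m<k = k ∸ suc m , sym (m+[n∸m]≡n m<k)

  -- Without an edge horizontal for x, the parity of the distance to x is a
  -- proper 2-colouring.
  ∃Hor : ¬ Bipartite G → ∀ x → ∃₂ λ u v → Adj G u v × Hor u v x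
  ∃Hor ¬bip x with Fin.any? (λ u → Fin.any? λ v → adj? G u v ×-dec (d u x ≟ d v x))
  ... | yes (u , v , h) = u , v , h
  ... | no  ¬h          = ⊥-elim (¬bip ((λ u → isOdd (d u x)) , proper))
    where
    isOdd-suc : ∀ {m k} → m ≢ k → m ≤ suc k → k ≤ suc m → isOdd m ≢ isOdd k
    isOdd-suc {m} {k} m≢k m≤ k≤ eq with <-cmp m k
    ... | tri< m<k _ _ = not-¬ (sym eq) (cong isOdd (≤-antisym k≤ m<k))
    ... | tri≈ _ m≡k _ = m≢k m≡k
    ... | tri> _ _ k<m = not-¬ eq (cong isOdd (≤-antisym m≤ k<m))

    proper : ∀ {u v} → Adj G u v → isOdd (d u x) ≢ isOdd (d v x)
    proper {u} {v} a = isOdd-suc (λ h → ¬h (u , v , a , h)) (d-step x a) (d-step x (adj-sym G a))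

-- The lower bound

-- If `a` vanishes, the other two are positive; if not, it adds at least 1 to the 1 coming from
-- `b + c`.
pairwise≥1⇒∑≥2 : ∀ {a b c} → 1 ≤ a + b → 1 ≤ b + c → 1 ≤ a + c → 2 ≤ a + b + c
pairwise≥1⇒∑≥2 {zero}        1≤b     _     1≤c = +-mono-≤ 1≤b 1≤c
pairwise≥1⇒∑≥2 {suc a} {b} {c} _ 1≤b+c   _   =
  s≤s (≤-trans 1≤b+c (≤-trans (m≤n+m (b + c) a) (≤-reflexive (sym (+-assoc a b c)))))

∑≤2⇒zero : ∀ {a b c} → a + b + c ≤ 2 → a ≡ 0 ⊎ b ≡ 0 ⊎ c ≡ 0
∑≤2⇒zero {zero}                       _  = inj₁ refl
∑≤2⇒zero {suc a} {zero}               _  = inj₂ (inj₁ refl)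
∑≤2⇒zero {suc a} {suc b} {zero}       _  = inj₂ (inj₂ refl)
∑≤2⇒zero {suc a} {suc b} {suc c}      le =
  contradiction (≤-trans (+-mono-≤ (+-mono-≤ (s≤s (z≤n {a})) (s≤s (z≤n {b}))) (s≤s (z≤n {c}))) le)
                λ { (s≤s (s≤s ())) }

module Transversal {n} (δ : Fin n → Fin n → ℕ) (δ-comm : ∀ x y → δ x y ≡ δ y x)
                   (t₁ t₂ t₃ : Fin n) (ws : List (Fin n)) (p : allFin n ↭ t₁ ∷ t₂ ∷ t₃ ∷ ws) where

  open ℕ-Solver.+-*-Solver using (solve; _:+_; _:*_; _:=_; con)

  V : List (Fin n)
  V = allFin n

  τ : Fin n → ℕ
  τ y = δ t₁ y + δ t₂ y + δ t₃ y

  total : ℕ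
  total = ∑[ x ∈ V ] ∑[ y ∈ V ] δ x y

  length-V : length V ≡ n
  length-V = length-tabulate id

  length-ws : n ≡ 3 + length ws
  length-ws = trans (sym length-V) (↭-length p)

  -- The rows of the three marked vertices make up `∑ V τ`. In each remaining row the three marked
  -- entries add up to `τ` again, by symmetry of `δ`, and the block over `ws` is left.
  total-split : total ≡ ∑ V τ + (∑ ws τ + ∑[ x ∈ ws ] ∑[ y ∈ ws ] δ x y)
  total-split = begin
    total
      ≡⟨ ∑-↭ (λ x → ∑ V (δ x)) p ⟩
    ∑ V (δ t₁) + (∑ V (δ t₂) + (∑ V (δ t₃) + ∑[ x ∈ ws ] ∑ V (δ x)))
      ≡⟨ reassoc (∑ V (δ t₁)) (∑ V (δ t₂)) (∑ V (δ t₃)) _ ⟩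
    ∑ V (δ t₁) + ∑ V (δ t₂) + ∑ V (δ t₃) + ∑[ x ∈ ws ] ∑ V (δ x)
      ≡⟨ cong₂ _+_ (sym (trans (∑-+ V _ _) (cong (_+ ∑ V (δ t₃)) (∑-+ V _ _)))) (∑-cong ws row) ⟩
    ∑ V τ + ∑[ x ∈ ws ] (τ x + ∑ ws (δ x))
      ≡⟨ cong (_+_ (∑ V τ)) (∑-+ ws τ _) ⟩
    ∑ V τ + (∑ ws τ + ∑[ x ∈ ws ] ∑ ws (δ x)) ∎
    where
    open ≡-Reasoning

    reassoc : ∀ a b c e → a + (b + (c + e)) ≡ a + b + c + e
    reassoc = solve 4 (λ a b c e → a :+ (b :+ (c :+ e)) := a :+ b :+ c :+ e) refl

    row : ∀ x → ∑ V (δ x) ≡ τ x + ∑ ws (δ x)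
    row x = begin
      ∑ V (δ x)                                       ≡⟨ ∑-↭ (δ x) p ⟩
      δ x t₁ + (δ x t₂ + (δ x t₃ + ∑ ws (δ x)))       ≡⟨ reassoc (δ x t₁) (δ x t₂) (δ x t₃) _ ⟩
      δ x t₁ + δ x t₂ + δ x t₃ + ∑ ws (δ x)
        ≡⟨ cong₂ (λ a b → a + b + δ x t₃ + ∑ ws (δ x)) (δ-comm x t₁) (δ-comm x t₂) ⟩
      δ t₁ x + δ t₂ x + δ x t₃ + ∑ ws (δ x)           ≡⟨ cong (λ a → δ t₁ x + δ t₂ x + a + ∑ ws (δ x)) (δ-comm x t₃) ⟩
      τ x + ∑ ws (δ x)                                ∎

  ∈-cover : ∀ y → y ≡ t₁ ⊎ y ≡ t₂ ⊎ y ≡ t₃ ⊎ y ∈ ws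
  ∈-cover y with ∈-resp-↭ p (∈-allFin y)
  ... | here eq                 = inj₁ eq
  ... | there (here eq)         = inj₂ (inj₁ eq)
  ... | there (there (here eq)) = inj₂ (inj₂ (inj₁ eq))
  ... | there (there (there y∈)) = inj₂ (inj₂ (inj₂ y∈))

  -- The upper counterpart for the converse, where it is applied to the explicit majorant `κ` of the
  -- excess.
  6+total≤4n : (∀ y → τ y ≤ 2) → (∀ {x y} → x ∈ ws → y ∈ ws → δ x y ≡ 0) → 6 + total ≤ 4 * n
  6+total≤4n τ≤2 δ≡0 = begin
    6 + total
      ≡⟨ cong (_+_ 6) total-split ⟩
    6 + (∑ V τ + (∑ ws τ + ∑[ x ∈ ws ] ∑[ y ∈ ws ] δ x y))
      ≤⟨ +-monoʳ-≤ 6 (+-mono-≤ (∑≤length* 2 V τ λ _ → τ≤2 _) (+-mono-≤ (∑≤length* 2 ws τ λ _ → τ≤2 _)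
           (≤-reflexive (∑-zero ws λ x∈ → ∑-zero ws (δ≡0 x∈))))) ⟩
    6 + (length V * 2 + (length ws * 2 + 0))
      ≡⟨ cong (λ k → 6 + (k * 2 + (length ws * 2 + 0))) (trans length-V length-ws) ⟩
    6 + ((3 + length ws) * 2 + (length ws * 2 + 0))
      ≡⟨ solve 1 (λ l → con 6 :+ ((con 3 :+ l) :* con 2 :+ (l :* con 2 :+ con 0))
                     := con 4 :* (con 3 :+ l)) refl (length ws) ⟩
    4 * (3 + length ws)
      ≡⟨ cong (4 *_) length-ws ⟨
    4 * n ∎
    where open ≤-Reasoning

  module _ (τ≥2 : ∀ y → 2 ≤ τ y) where

    private
      ℓ R : ℕ
      ℓ = length ws
      R = ∑[ x ∈ ws ] ∑[ y ∈ ws ] δ x y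

      V-bound : (3 + ℓ) * 2 ≤ ∑ V τ
      V-bound = subst (λ k → k * 2 ≤ ∑ V τ) (trans length-V length-ws) (length*≤∑ 2 V τ λ _ → τ≥2 _)

      ws-bound : ℓ * 2 ≤ ∑ ws τ
      ws-bound = length*≤∑ 2 ws τ λ _ → τ≥2 _

      4n≡ : 4 * n ≡ 6 + ((3 + ℓ) * 2 + ℓ * 2)
      4n≡ = trans (cong (4 *_) length-ws)
        (solve 1 (λ l → con 4 :* (con 3 :+ l) := con 6 :+ ((con 3 :+ l) :* con 2 :+ l :* con 2)) refl ℓ)

    -- The marked rows give 2 n and the marked columns outside them 2 (n - 3). The 6 is moved to the
    -- other side to avoid truncated subtraction.
    4n≤6+total : 4 * n ≤ 6 + total
    4n≤6+total = begin
      4 * n                            ≡⟨ 4n≡ ⟩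
      6 + ((3 + ℓ) * 2 + ℓ * 2)        ≤⟨ +-monoʳ-≤ 6 (+-mono-≤ V-bound (≤-trans ws-bound (m≤m+n _ R))) ⟩
      6 + (∑ V τ + (∑ ws τ + R))       ≡⟨ cong (_+_ 6) total-split ⟨
      6 + total                        ∎
      where open ≤-Reasoning

    module _ (tight : 6 + total ≤ 4 * n) where

      private
        tight′ : ∑ V τ + (∑ ws τ + R) ≤ (3 + ℓ) * 2 + ℓ * 2
        tight′ = +-cancelˡ-≤ 6 _ _ (subst₂ _≤_ (cong (_+_ 6) total-split) 4n≡ tight)

      τ≤2 : ∀ y → τ y ≤ 2
      τ≤2 y = ∑-tight 2 V τ (λ _ → τ≥2 _) ∑≤ (∈-allFin y)
        where
        ∑≤ : ∑ V τ ≤ length V * 2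
        ∑≤ = subst (λ k → ∑ V τ ≤ k * 2) (sym (trans length-V length-ws))
          (+-cancelʳ-≤ (ℓ * 2) _ _ (≤-trans (+-monoʳ-≤ (∑ V τ) (≤-trans ws-bound (m≤m+n _ R))) tight′))

      δ-ws≡0 : ∀ {x y} → x ∈ ws → y ∈ ws → δ x y ≡ 0
      δ-ws≡0 {x} x∈ y∈ = n≤0⇒n≡0 (≤-trans (∈⇒≤∑ (δ x) y∈) (≤-trans (∈⇒≤∑ (λ x → ∑ ws (δ x)) x∈) R≤0))
        where
        R≤0 : R ≤ 0
        R≤0 = +-cancelˡ-≤ ((3 + ℓ) * 2 + ℓ * 2) _ _ (begin
          (3 + ℓ) * 2 + ℓ * 2 + R     ≡⟨ +-assoc ((3 + ℓ) * 2) (ℓ * 2) R ⟩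
          (3 + ℓ) * 2 + (ℓ * 2 + R)   ≤⟨ +-mono-≤ V-bound (+-monoˡ-≤ R ws-bound) ⟩
          ∑ V τ + (∑ ws τ + R)        ≤⟨ tight′ ⟩
          (3 + ℓ) * 2 + ℓ * 2         ≡⟨ +-identityʳ _ ⟨
          (3 + ℓ) * 2 + ℓ * 2 + 0     ∎)
          where open ≤-Reasoning

module LowerBound {n} {G : Graph n} (d : Fin n → Fin n → ℕ)
                  (geodesic : ∀ u v → Least (Walk G u v) (d u v)) (¬bip : ¬ Bipartite G) where

  open Metric {G = G} d geodesic

  open ℕ-Solver.+-*-Solver using (solve; _:+_; _:*_; _:=_; con)

  z≥1 : ∀ x y → 1 ≤ z x y
  z≥1 x y =
    let u , v , a , h = ∃Hor ¬bip x
    in subst (_≤ z x y) (Hor⇒hor x y (inj₁ h)) (∈⇒≤∑ _ (⟨⟩∈edges G a))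

  -- Both `x` and `y` have a horizontal edge, and `z x y ≤ 1` leaves room for only one between them.
  Hor-transfer : ∀ {u v} x y → z x y ≤ 1 → Adj G u v → Hor u v x → Hor u v y
  Hor-transfer x y z≤1 a h =
    let _ , _ , a′ , h′ = ∃Hor ¬bip y
    in Hor-⟨⟩ y (z≤1⇒≡ x y z≤1 a′ a (inj₂ h′) (inj₁ h)) h′

  Isosceles : ℕ → Set
  Isosceles k = ∃ λ u → ∃ λ v → ∃ λ x → Adj G u v × d u x ≡ k × d v x ≡ k

  isosceles? : ∀ k → Dec (Isosceles k)
  isosceles? k = Fin.any? λ u → Fin.any? λ v → Fin.any? λ x → adj? G u v ×-dec (d u x ≟ k) ×-dec (d v x ≟ k)

  least-isosceles : Fin n → ∃ (Least Isosceles)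
  least-isosceles v₀ =
    let u , v , a , h = ∃Hor ¬bip v₀
    in least isosceles? (d v v₀ , u , v , v₀ , a , h , refl)

  -- The first vertex `y` on a geodesic from `x` to `u` has distance j or j + 1 from `v`, and j
  -- would make it an apex with legs j. So `xy` is horizontal for `v`.
  descend : ∀ {u v x j} → ¬ Isosceles j → Adj G u v → d u x ≡ suc j → d v x ≡ suc j →
            ∃ λ y → Adj G x y × d y u ≡ j × d y v ≡ suc j
  descend {u} {v} {x} {j} ¬j a ux vx =
    let y , b , yu = firstStep (trans (d-sym x u) ux)
        yv≤        = ≤-trans (d-stepʳ y (adj-sym G a)) (≤-reflexive (cong suc yu))
        yv≥        = ≤-pred (≤-trans (≤-reflexive (trans (sym vx) (d-sym v x))) (d-step v b))
        yv≢        = λ yv≡j → ¬j (u , v , y , a , trans (d-sym u y) yu , trans (d-sym v y) yv≡j)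
    in y , b , yu , ≤-antisym yv≤ (≤∧≢⇒< yv≥ (yv≢ ∘ sym))

  -- Excess over the guaranteed minimum 2 d + 1, whose 1 comes from `z≥1`. By `1+2d≤` the
  -- subtraction never truncates.
  δ : Fin n → Fin n → ℕ
  δ x y = 2 * s x y + z x y ∸ (1 + 2 * d x y)

  1+2d≤ : ∀ x y → 1 + 2 * d x y ≤ 2 * s x y + z x y
  1+2d≤ x y = ≤-trans (≤-reflexive (+-comm 1 _)) (+-mono-≤ (*-monoʳ-≤ 2 (d≤s x y)) (z≥1 x y))

  2s+z≡ : ∀ x y → 2 * s x y + z x y ≡ 1 + 2 * d x y + δ x y
  2s+z≡ x y = sym (m+[n∸m]≡n (1+2d≤ x y))

  δ-comm : ∀ x y → δ x y ≡ δ y x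
  δ-comm x y = cong₂ _∸_ (cong₂ (λ a b → 2 * a + b) (s-comm x y) (z-comm x y))
                         (cong (λ a → 1 + 2 * a) (d-sym x y))

  z≤1+δ : ∀ x y → z x y ≤ 1 + δ x y
  z≤1+δ x y = +-cancelˡ-≤ (2 * d x y) _ _ (begin
    2 * d x y + z x y        ≤⟨ +-monoˡ-≤ (z x y) (*-monoʳ-≤ 2 (d≤s x y)) ⟩
    2 * s x y + z x y        ≡⟨ 2s+z≡ x y ⟩
    1 + 2 * d x y + δ x y    ≡⟨ +-suc (2 * d x y) (δ x y) ⟨
    2 * d x y + (1 + δ x y)  ∎)
    where open ≤-Reasoning

  -- Every separating edge beyond the distance costs 2, more than an excess of 1 can pay.
  δ≤1⇒s≤d : ∀ x y → δ x y ≤ 1 → s x y ≤ d x y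
  δ≤1⇒s≤d x y δ≤1 = ≮⇒≥ λ d<s → <⇒≱ ≤-refl (begin
    3 + 2 * d x y            ≡⟨ solve 1 (λ a → con 3 :+ con 2 :* a := con 2 :* (con 1 :+ a) :+ con 1) refl (d x y) ⟩
    2 * suc (d x y) + 1      ≤⟨ +-mono-≤ (*-monoʳ-≤ 2 d<s) (z≥1 x y) ⟩
    2 * s x y + z x y        ≡⟨ 2s+z≡ x y ⟩
    1 + 2 * d x y + δ x y    ≤⟨ +-monoʳ-≤ (1 + 2 * d x y) δ≤1 ⟩
    1 + 2 * d x y + 1        ≡⟨ +-comm _ 1 ⟩
    2 + 2 * d x y            ∎)
    where open ≤-Reasoning

  -- Triangle inequality for z - 1 through `w`: were both excesses zero, `z x w` and `z w y` would
  -- sum to at most 2, but submodularity makes that sum at least 2 + `z w w`.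
  z≥2⇒δ+δ≥1 : ∀ {x y} w → 2 ≤ z x y → 1 ≤ δ x w + δ y w
  z≥2⇒δ+δ≥1 {x} {y} w z≥2 = +-cancelˡ-≤ 2 _ _ (begin
    3                              ≤⟨ +-mono-≤ z≥2 (z≥1 w w) ⟩
    z x y + z w w                  ≤⟨ z-submodular x w y ⟩
    z x w + z w y                  ≤⟨ +-mono-≤ (z≤1+δ x w) (≤-trans (≤-reflexive (z-comm w y)) (z≤1+δ y w)) ⟩
    1 + δ x w + (1 + δ y w)        ≡⟨ cong suc (+-suc (δ x w) (δ y w)) ⟩
    2 + (δ x w + δ y w)            ∎)
    where open ≤-Reasoning

  -- In the resulting decomposition `c` carries the tree, and `a`, `b` are the two vertices of
  -- degree 2.
  record Extremal : Set where
    field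
      {a b c} : Fin n
      a∼b   : Adj G a b
      b∼c   : Adj G b c
      a∼c   : Adj G a c
      z≤1   : ∀ y → z y y ≤ 1
      s≤d   : ∀ x y → s x y ≤ d x y
      -- z c y ≤ 1 means that ab, the edge opposite to c, is the horizontal edge of y too.
      like-c : ∀ y → y ≡ a ⊎ y ≡ b ⊎ z c y ≤ 1

  module Isosceles-triangle {u v x j} (u∼v : Adj G u v) (ux : d u x ≡ suc j) (vx : d v x ≡ suc j)
                            (min : ∀ i → Isosceles i → suc j ≤ i) where

    ¬isosceles-j : ¬ Isosceles j
    ¬isosceles-j = 1+n≰n ∘ min j

    toward-u : ∃ λ y → Adj G x y × d y u ≡ j × d y v ≡ suc j
    toward-u = descend ¬isosceles-j u∼v ux vx

    toward-v : ∃ λ y → Adj G x y × d y v ≡ j × d y u ≡ suc j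
    toward-v = descend ¬isosceles-j (adj-sym G u∼v) vx ux

    xᵤ xᵥ : Fin n
    xᵤ = proj₁ toward-u
    xᵥ = proj₁ toward-v

    x∼xᵤ : Adj G x xᵤ
    x∼xᵤ = proj₁ (proj₂ toward-u)

    x∼xᵥ : Adj G x xᵥ
    x∼xᵥ = proj₁ (proj₂ toward-v)

    Hor-xᵤ : Hor x xᵤ v
    Hor-xᵤ = trans (trans (d-sym x v) vx) (sym (proj₂ (proj₂ (proj₂ toward-u))))

    Hor-xᵥ : Hor x xᵥ u
    Hor-xᵥ = trans (trans (d-sym x u) ux) (sym (proj₂ (proj₂ (proj₂ toward-v))))

    Hor-uv : Hor u v x
    Hor-uv = trans ux (sym vx)

    ¬Hor-uv-u : ¬ Hor u v u
    ¬Hor-uv-u h = adj⇒≢ G u∼v (sym (d≡0⇒≡ (trans (sym h) (d-refl u))))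

    ¬Hor-uv-v : ¬ Hor u v v
    ¬Hor-uv-v h = adj⇒≢ G u∼v (d≡0⇒≡ (trans h (d-refl v)))

    ¬Hor-xᵤ-u : ¬ Hor x xᵤ u
    ¬Hor-xᵤ-u h = 1+n≢n (trans (sym (trans (d-sym x u) ux)) (trans h (proj₁ (proj₂ (proj₂ toward-u)))))

    -- In this and the next two bounds each member of the pair brings its own edge: `uv` for `x`,
    -- `x xᵥ` for `u`, `x xᵤ` for `v`. Two of them never coincide, because one is horizontal for a
    -- vertex for which the other is not.
    zxu : 2 ≤ z x u
    zxu = z≥2 x u u∼v x∼xᵥ (λ eq → ¬Hor-uv-u (Hor-⟨⟩ u (sym eq) Hor-xᵥ)) (inj₁ Hor-uv) (inj₂ Hor-xᵥ)

    zuv : 2 ≤ z u v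
    zuv = z≥2 u v x∼xᵤ x∼xᵥ (λ eq → ¬Hor-xᵤ-u (Hor-⟨⟩ u (sym eq) Hor-xᵥ)) (inj₂ Hor-xᵤ) (inj₁ Hor-xᵥ)

    zxv : 2 ≤ z x v
    zxv = z≥2 x v u∼v x∼xᵤ (λ eq → ¬Hor-uv-v (Hor-⟨⟩ v (sym eq) Hor-xᵤ)) (inj₁ Hor-uv) (inj₂ Hor-xᵤ)

    u≢x : u ≢ x
    u≢x refl = 0≢1+n (trans (sym (d-refl u)) ux)

    v≢x : v ≢ x
    v≢x refl = 0≢1+n (trans (sym (d-refl v)) vx)

    cover : ∃ λ ws → allFin n ↭ x ∷ u ∷ v ∷ ws
    cover = allFin↭∷∷∷ (u≢x ∘ sym) (adj⇒≢ G u∼v) (v≢x ∘ sym)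

    open Transversal δ δ-comm x u v (proj₁ cover) (proj₂ cover)
      using (τ; total; length-ws; ∈-cover; 4n≤6+total; τ≤2; δ-ws≡0)

    τ≥2 : ∀ y → 2 ≤ τ y
    τ≥2 y = pairwise≥1⇒∑≥2 {δ x y} (z≥2⇒δ+δ≥1 y zxu) (z≥2⇒δ+δ≥1 y zuv) (z≥2⇒δ+δ≥1 y zxv)

    bound : 4 * n ≤ 6 + total
    bound = 4n≤6+total τ≥2

    module _ (4≤n : 4 ≤ n) (tight : 6 + total ≤ 4 * n) where

      private
        τ-bound : ∀ y → δ x y + δ u y + δ v y ≤ 2
        τ-bound = τ≤2 τ≥2 tight

      -- By `zuv` the other two members of the triple already take 1 of the total 2. The next two
      -- bounds repeat this with the roles permuted.
      δ-xy≤1 : ∀ y → δ x y ≤ 1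
      δ-xy≤1 y = +-cancelʳ-≤ 1 _ _ (begin
        δ x y + 1                ≤⟨ +-monoʳ-≤ (δ x y) (z≥2⇒δ+δ≥1 y zuv) ⟩
        δ x y + (δ u y + δ v y)  ≡⟨ +-assoc (δ x y) _ _ ⟨
        δ x y + δ u y + δ v y    ≤⟨ τ-bound y ⟩
        2                        ∎)
        where open ≤-Reasoning

      δ-uy≤1 : ∀ y → δ u y ≤ 1
      δ-uy≤1 y = +-cancelʳ-≤ 1 _ _ (begin
        δ u y + 1                ≤⟨ +-monoʳ-≤ (δ u y) (z≥2⇒δ+δ≥1 y zxv) ⟩
        δ u y + (δ x y + δ v y)  ≡⟨ solve 3 (λ a b c → b :+ (a :+ c) := a :+ b :+ c) refl (δ x y) (δ u y) (δ v y) ⟩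
        δ x y + δ u y + δ v y    ≤⟨ τ-bound y ⟩
        2                        ∎)
        where open ≤-Reasoning

      δ-vy≤1 : ∀ y → δ v y ≤ 1
      δ-vy≤1 y = +-cancelˡ-≤ 1 _ _ (begin
        1 + δ v y                ≤⟨ +-monoˡ-≤ (δ v y) (z≥2⇒δ+δ≥1 y zxu) ⟩
        δ x y + δ u y + δ v y    ≤⟨ τ-bound y ⟩
        2                        ∎)
        where open ≤-Reasoning

      δ≤1 : ∀ w y → δ w y ≤ 1
      δ≤1 w y with ∈-cover w | ∈-cover y
      ... | inj₁ refl                      | _ = δ-xy≤1 y
      ... | inj₂ (inj₁ refl)               | _ = δ-uy≤1 y
      ... | inj₂ (inj₂ (inj₁ refl))        | _ = δ-vy≤1 y
      ... | inj₂ (inj₂ (inj₂ w∈))          | inj₁ refl               = subst (_≤ 1) (δ-comm y w) (δ-xy≤1 w)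
      ... | inj₂ (inj₂ (inj₂ w∈))          | inj₂ (inj₁ refl)        = subst (_≤ 1) (δ-comm y w) (δ-uy≤1 w)
      ... | inj₂ (inj₂ (inj₂ w∈))          | inj₂ (inj₂ (inj₁ refl)) = subst (_≤ 1) (δ-comm y w) (δ-vy≤1 w)
      ... | inj₂ (inj₂ (inj₂ w∈))          | inj₂ (inj₂ (inj₂ y∈))   = ≤-trans (≤-reflexive (δ-ws≡0 τ≥2 tight w∈ y∈)) z≤n

      δ≡0⇒z≤1 : ∀ {w y} → δ w y ≡ 0 → z w y ≤ 1
      δ≡0⇒z≤1 {w} {y} eq = subst (λ k → z w y ≤ 1 + k) eq (z≤1+δ w y)

      δ≥1 : ∀ {w y} → 2 ≤ z w y → 1 ≤ δ w y
      δ≥1 {w} {y} le = ≤-pred (≤-trans le (z≤1+δ w y))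

      -- A member of the triple has excess at least 1 towards each of the other two, which exhausts
      -- its total of 2; every other vertex lies in the block without excess.
      δ-diag : ∀ y → δ y y ≡ 0
      δ-diag y with ∈-cover y
      ... | inj₁ refl = n≤0⇒n≡0 (+-cancelʳ-≤ 2 _ _
        (≤-trans (≤-reflexive (sym (+-assoc (δ x x) 1 1)))
        (≤-trans (+-mono-≤ (+-monoʳ-≤ (δ x x) (δ≥1 (subst (2 ≤_) (z-comm x u) zxu)))
                   (δ≥1 (subst (2 ≤_) (z-comm x v) zxv)))
                 (τ-bound x))))
      ... | inj₂ (inj₁ refl) = n≤0⇒n≡0 (+-cancelˡ-≤ 1 _ _ (+-cancelʳ-≤ 1 _ _
        (≤-trans (+-mono-≤ (+-monoˡ-≤ (δ u u) (δ≥1 zxu)) (δ≥1 (subst (2 ≤_) (z-comm u v) zuv))) (τ-bound u))))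
      ... | inj₂ (inj₂ (inj₁ refl)) = n≤0⇒n≡0 (+-cancelˡ-≤ 2 _ _
        (≤-trans (+-monoˡ-≤ (δ v v) (+-mono-≤ (δ≥1 zxv) (δ≥1 zuv))) (τ-bound v)))
      ... | inj₂ (inj₂ (inj₂ y∈)) = δ-ws≡0 τ≥2 tight y∈ y∈

      like-one : ∀ y → z x y ≤ 1 ⊎ z u y ≤ 1 ⊎ z v y ≤ 1
      like-one y = Sum.map δ≡0⇒z≤1 (Sum.map δ≡0⇒z≤1 δ≡0⇒z≤1) (∑≤2⇒zero (τ-bound y))

      -- The neighbour of x towards u shares its horizontal edge with one of x, u, v,
      -- and only u is possible; this exhibits an isosceles triple with legs of length 1.
      j≡0 : j ≡ 0
      j≡0 = case like-one xᵤ of λ where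
        (inj₁ le) → contradiction
          (trans (trans (sym (proj₁ (proj₂ (proj₂ toward-u)))) (trans (d-sym xᵤ u) (Hor-transfer x xᵤ le u∼v Hor-uv)))
                 (trans (d-sym v xᵤ) (proj₂ (proj₂ (proj₂ toward-u))))) (1+n≢n ∘ sym)
        (inj₂ (inj₂ le)) → contradiction
          (trans (sym (adj⇒d≡1 x∼xᵤ)) (trans (Hor-transfer v xᵤ le x∼xᵤ Hor-xᵤ) (d-refl xᵤ))) λ ()
        (inj₂ (inj₁ le)) → n≤0⇒n≡0 (≤-pred (min 1
          (x , xᵥ , xᵤ , x∼xᵥ , adj⇒d≡1 x∼xᵤ , trans (sym (Hor-transfer u xᵤ le x∼xᵥ Hor-xᵥ)) (adj⇒d≡1 x∼xᵤ))))

      u∼x : Adj G u x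
      u∼x = d≡1⇒adj (trans ux (cong suc j≡0))

      v∼x : Adj G v x
      v∼x = d≡1⇒adj (trans vx (cong suc j≡0))

      z-diag : ∀ y → z y y ≤ 1
      z-diag y = δ≡0⇒z≤1 (δ-diag y)

      -- Without excess inside the block, `w` and `y` share their horizontal edge, so agreement of
      -- `c` with `w` passes to `y` by submodularity.
      z-like : ∀ {c w y} → z c w ≤ 1 → w ∈ proj₁ cover → y ∈ proj₁ cover → z c y ≤ 1
      z-like {c} {w} {y} le w∈ y∈ = +-cancelʳ-≤ 1 _ _ (begin
        z c y + 1        ≤⟨ +-monoʳ-≤ (z c y) (z≥1 w w) ⟩
        z c y + z w w    ≤⟨ z-submodular c w y ⟩
        z c w + z w y    ≤⟨ +-mono-≤ le (δ≡0⇒z≤1 (δ-ws≡0 τ≥2 tight w∈ y∈)) ⟩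
        2                ∎)
        where open ≤-Reasoning

      -- A fourth vertex, available since n ≥ 4, decides which of `x`, `u`, `v` becomes the
      -- attachment vertex: the one whose horizontal edge it shares.
      ∃∈ws : ∃ λ w → w ∈ proj₁ cover
      ∃∈ws = nonempty (proj₁ cover) (+-cancelˡ-≤ 3 _ _ (subst (4 ≤_) length-ws 4≤n))
        where
        nonempty : ∀ ws → 1 ≤ length ws → ∃ λ (w : Fin n) → w ∈ ws
        nonempty (w ∷ _) _ = w , here refl

      module _ {w} (w∈ : w ∈ proj₁ cover) where

        extremal-with-apex : ∀ {a b c} → Adj G a b → Adj G b c → Adj G a c → z c w ≤ 1 →
                             (∀ y → y ≡ a ⊎ y ≡ b ⊎ y ≡ c ⊎ y ∈ proj₁ cover) → Extremal
        extremal-with-apex {a} {b} {c} a∼b b∼c a∼c le cov = record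
          { a∼b = a∼b ; b∼c = b∼c ; a∼c = a∼c ; z≤1 = z-diag
          ; s≤d = λ y y′ → δ≤1⇒s≤d y y′ (δ≤1 y y′)
          ; like-c = λ y → Sum.map₂ (Sum.map₂ (alike y)) (cov y) }
          where
          alike : ∀ y → y ≡ c ⊎ y ∈ proj₁ cover → z c y ≤ 1
          alike y (inj₁ refl) = z-diag y
          alike y (inj₂ y∈)   = z-like le w∈ y∈

      extremal : Extremal
      extremal =
        let w , w∈ = ∃∈ws in case like-one w of λ where
          (inj₁ le)        → extremal-with-apex w∈ u∼v v∼x u∼x le λ y → rotate (∈-cover y)
          (inj₂ (inj₁ le)) → extremal-with-apex w∈ v∼x (adj-sym G u∼x) (adj-sym G u∼v) le
                               λ y → rotate (rotate (∈-cover y))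
          (inj₂ (inj₂ le)) → extremal-with-apex w∈ (adj-sym G u∼x) u∼v (adj-sym G v∼x) le ∈-cover
        where
        rotate : ∀ {P Q R S : Set} → P ⊎ Q ⊎ R ⊎ S → Q ⊎ R ⊎ P ⊎ S
        rotate (inj₁ p)               = inj₂ (inj₂ (inj₁ p))
        rotate (inj₂ (inj₁ q))        = inj₁ q
        rotate (inj₂ (inj₂ (inj₁ r))) = inj₂ (inj₁ r)
        rotate (inj₂ (inj₂ (inj₂ s))) = inj₂ (inj₂ (inj₂ s))

  ∑δ : ℕ
  ∑δ = ∑[ x ∈ allFin n ] ∑[ y ∈ allFin n ] δ x y

  ∑δ-bound : Fin n → 4 * n ≤ 6 + ∑δ
  ∑δ-bound v₀ with least-isosceles v₀
  ... | zero  , (u , v , x , a , ux , vx) , min = contradiction (trans (d≡0⇒≡ ux) (sym (d≡0⇒≡ vx))) (adj⇒≢ G a)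
  ... | suc j , (u , v , x , a , ux , vx) , min = Isosceles-triangle.bound a ux vx min

  ∑δ-tight : Fin n → 4 ≤ n → 6 + ∑δ ≤ 4 * n → Extremal
  ∑δ-tight v₀ with least-isosceles v₀
  ... | zero  , (u , v , x , a , ux , vx) , min = contradiction (trans (d≡0⇒≡ ux) (sym (d≡0⇒≡ vx))) (adj⇒≢ G a)
  ... | suc j , (u , v , x , a , ux , vx) , min = Isosceles-triangle.extremal a ux vx min

-- The structure of extremal graphs

C₃-complete : ∀ i j → i ≢ j → Adj C₃ i j
C₃-complete zero             zero             i≢j = contradiction refl i≢j
C₃-complete zero             (suc zero)       _   = inj₁ (inj₁ refl)
C₃-complete zero             (suc (suc zero)) _   = inj₂ (inj₂ (refl , refl))
C₃-complete (suc zero)       zero             _   = inj₂ (inj₁ refl)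
C₃-complete (suc zero)       (suc zero)       i≢j = contradiction refl i≢j
C₃-complete (suc zero)       (suc (suc zero)) _   = inj₁ (inj₁ refl)
C₃-complete (suc (suc zero)) zero             _   = inj₁ (inj₂ (refl , refl))
C₃-complete (suc (suc zero)) (suc zero)       _   = inj₂ (inj₁ refl)
C₃-complete (suc (suc zero)) (suc (suc zero)) i≢j = contradiction refl i≢j

-- Serves two retractions onto the tree: one shows that the tree is connected, the other transfers
-- its bridges to `G`. Edges may be contracted, so only existence of a walk survives, not its
-- length.
collapseʷ : ∀ {n m} {G : Graph n} {H : Graph m} (ρ : Fin n → Fin m) →
            (∀ {u v} → Adj G u v → ρ u ≡ ρ v ⊎ Adj H (ρ u) (ρ v)) →
            ∀ {u v k} → Walk G u v k → ∃ (Walk H (ρ u) (ρ v))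
collapseʷ ρ ρ-adj [] = 0 , []
collapseʷ {H = H} ρ ρ-adj {v = v} (a ∷ p) with ρ-adj a | collapseʷ {H = H} ρ ρ-adj p
... | inj₁ eq | k , q = k , subst (λ w → Walk H w (ρ v) k) (sym eq) q
... | inj₂ b  | k , q = suc k , b ∷ q

module ExtremalStructure
  {m} {G : Graph (2 + m)} (d : Fin (2 + m) → Fin (2 + m) → ℕ)
  (geodesic : ∀ u v → Least (Walk G u v) (d u v)) (conn : Connected G) (¬bip : ¬ Bipartite G)
  (ext : LowerBound.Extremal {G = G} d geodesic ¬bip) where

  open Metric {G = G} d geodesic
  open LowerBound {G = G} d geodesic ¬bip
  open Extremal ext

  a≢b : a ≢ b
  a≢b = adj⇒≢ G a∼b

  b≢c : b ≢ c
  b≢c = adj⇒≢ G b∼c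

  a≢c : a ≢ c
  a≢c = adj⇒≢ G a∼c

  Hor-ab : ∀ {y} → y ≢ a → y ≢ b → Hor a b y
  Hor-ab {y} y≢a y≢b with like-c y
  ... | inj₁ y≡a        = contradiction y≡a y≢a
  ... | inj₂ (inj₁ y≡b) = contradiction y≡b y≢b
  ... | inj₂ (inj₂ le)  = Hor-transfer c y le a∼b (trans (adj⇒d≡1 a∼c) (sym (adj⇒d≡1 b∼c)))

  Hor-bc : Hor b c a
  Hor-bc = trans (adj⇒d≡1 (adj-sym G a∼b)) (sym (adj⇒d≡1 (adj-sym G a∼c)))

  Hor-ac : Hor a c b
  Hor-ac = trans (adj⇒d≡1 a∼b) (sym (adj⇒d≡1 (adj-sym G b∼c)))

  Hor-unique : ∀ {u v u′ v′} y → Adj G u v → Adj G u′ v′ → Hor u v y → Hor u′ v′ y → ⟨ u , v ⟩ ≡ ⟨ u′ , v′ ⟩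
  Hor-unique y e e′ h h′ = z≤1⇒≡ y y (z≤1 y) e e′ (inj₁ h) (inj₁ h′)

  -- A neighbour `y` of `a` other than `b` is equidistant from `a` and `b`, hence adjacent to `b`.
  -- This makes `ay` horizontal for `b`, whose only horizontal edge is `ac`.
  nbr-a : ∀ {y} → Adj G a y → y ≡ b ⊎ y ≡ c
  nbr-a {y} a∼y with y Fin.≟ b
  ... | yes y≡b = inj₁ y≡b
  ... | no  y≢b = inj₂ (⟨⟩-cancelˡ (Hor-unique b a∼y a∼c
    (trans (adj⇒d≡1 a∼b) (trans (sym (adj⇒d≡1 a∼y)) (trans (Hor-ab (adj⇒≢ G a∼y ∘ sym) y≢b) (d-sym b y)))) Hor-ac))

  nbr-b : ∀ {y} → Adj G b y → y ≡ a ⊎ y ≡ c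
  nbr-b {y} b∼y with y Fin.≟ a
  ... | yes y≡a = inj₁ y≡a
  ... | no  y≢a = inj₂ (⟨⟩-cancelˡ (Hor-unique a b∼y b∼c
    (trans (adj⇒d≡1 (adj-sym G a∼b)) (trans (sym (adj⇒d≡1 b∼y))
      (trans (sym (Hor-ab y≢a (adj⇒≢ G b∼y ∘ sym))) (d-sym a y)))) Hor-bc))

  b′ : Fin (1 + m)
  b′ = punchOut a≢b

  g : Fin m → Fin (2 + m)
  g i = punchIn a (punchIn b′ i)

  g≢a : ∀ i → g i ≢ a
  g≢a i = Fin.punchInᵢ≢i a (punchIn b′ i)

  g≢b : ∀ i → g i ≢ b
  g≢b i eq = Fin.punchInᵢ≢i b′ i
    (Fin.punchIn-injective a _ _ (trans eq (sym (Fin.punchIn-punchOut a≢b))))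

  g-injective : Injective _≡_ _≡_ g
  g-injective eq = Fin.punchIn-injective b′ _ _ (Fin.punchIn-injective a _ _ eq)

  g-surjective : ∀ {v} → v ≢ a → v ≢ b → ∃ λ i → g i ≡ v
  g-surjective {v} v≢a v≢b = punchOut b′≢v′ ,
    trans (cong (punchIn a) (Fin.punchIn-punchOut b′≢v′)) (Fin.punchIn-punchOut a≢v)
    where
    a≢v : a ≢ v
    a≢v = v≢a ∘ sym

    b′≢v′ : b′ ≢ punchOut a≢v
    b′≢v′ eq = v≢b (sym (Fin.punchOut-injective a≢b a≢v eq))

  T : Graph m
  T = record
    { Adj    = λ i j → Adj G (g i) (g j)
    ; adj?   = λ i j → adj? G (g i) (g j)
    ; sym    = adj-sym G
    ; irrefl = λ { refl → Graph.irrefl G refl }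
    }

  c₀ : Fin m
  c₀ = proj₁ (g-surjective (a≢c ∘ sym) (b≢c ∘ sym))

  g-c₀ : g c₀ ≡ c
  g-c₀ = proj₂ (g-surjective (a≢c ∘ sym) (b≢c ∘ sym))

  retraction : ∀ v → ∃ λ i → (g i ≡ v) ⊎ ((v ≡ a ⊎ v ≡ b) × i ≡ c₀)
  retraction v with v Fin.≟ a | v Fin.≟ b
  ... | yes v≡a | _       = c₀ , inj₂ (inj₁ v≡a , refl)
  ... | no  _   | yes v≡b = c₀ , inj₂ (inj₂ v≡b , refl)
  ... | no  v≢a | no v≢b  = let i , eq = g-surjective v≢a v≢b in i , inj₁ eq

  ρ : Fin (2 + m) → Fin m
  ρ v = proj₁ (retraction v)

  ρ-g : ∀ i → ρ (g i) ≡ i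
  ρ-g i with retraction (g i)
  ... | _ , inj₁ eq            = g-injective eq
  ... | _ , inj₂ (inj₁ eq , _) = contradiction eq (g≢a i)
  ... | _ , inj₂ (inj₂ eq , _) = contradiction eq (g≢b i)

  ρ-c : ∀ {i u v} → Adj G u v → g i ≡ u → v ≡ a ⊎ v ≡ b → i ≡ c₀
  ρ-c {i} u∼v refl (inj₁ refl) with nbr-a (adj-sym G u∼v)
  ... | inj₁ eq = contradiction eq (g≢b i)
  ... | inj₂ eq = g-injective (trans eq (sym g-c₀))
  ρ-c {i} u∼v refl (inj₂ refl) with nbr-b (adj-sym G u∼v)
  ... | inj₁ eq = contradiction eq (g≢a i)
  ... | inj₂ eq = g-injective (trans eq (sym g-c₀))

  -- An edge leaving {a, b} ends at `c`, so sending `a` and `b` to `c` contracts it.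
  ρ-adj : ∀ {u v} → Adj G u v → ρ u ≡ ρ v ⊎ Adj T (ρ u) (ρ v)
  ρ-adj {u} {v} u∼v with retraction u | retraction v
  ... | _ , inj₁ refl       | _ , inj₁ refl        = inj₂ u∼v
  ... | _ , inj₁ eq         | _ , inj₂ (v∈ , refl) = inj₁ (ρ-c u∼v eq v∈)
  ... | _ , inj₂ (u∈ , eq)  | _ , inj₁ eq′         = inj₁ (trans eq (sym (ρ-c (adj-sym G u∼v) eq′ u∈)))
  ... | _ , inj₂ (_ , eq)   | _ , inj₂ (_ , eq′)   = inj₁ (trans eq (sym eq′))

  T-connected : Connected T
  T-connected i j =
    subst₂ (λ i j → ∃ (Walk T i j)) (ρ-g i) (ρ-g j)
           (collapseʷ {G = G} {H = T} ρ ρ-adj (proj₂ (conn (g i) (g j))))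

  -- The single horizontal edge of any vertex is a side of the triangle, so it has `a` or `b` as an
  -- end; edges of `T` avoid both.
  ¬Hor-T : ∀ {i j} y → Adj T i j → ¬ Hor (g i) (g j) y
  ¬Hor-T {i} {j} y e h with y Fin.≟ a | y Fin.≟ b
  ... | yes refl | _ with ⟨⟩-injective (Hor-unique a e b∼c h Hor-bc)
  ...   | inj₁ (eq , _) = g≢b i eq
  ...   | inj₂ (_ , eq) = g≢b j eq
  ¬Hor-T {i} {j} y e h | no _ | yes refl with ⟨⟩-injective (Hor-unique b e a∼c h Hor-ac)
  ...   | inj₁ (eq , _) = g≢a i eq
  ...   | inj₂ (_ , eq) = g≢a j eq
  ¬Hor-T {i} {j} y e h | no y≢a | no y≢b with ⟨⟩-injective (Hor-unique y e a∼b h (Hor-ab y≢a y≢b))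
  ...   | inj₁ (eq , _) = g≢a i eq
  ...   | inj₂ (_ , eq) = g≢a j eq

  farther : ∀ {p q} w → Adj G p q → d p w < d q w → d q w ≡ suc (d p w)
  farther w p∼q lt = ≤-antisym (d-step w (adj-sym G p∼q)) lt

  -- The edge `xy` separates its own ends, and s ≤ d = 1 excludes a second one.
  ¬Sep : ∀ {x y p q} → Adj G x y → Adj G p q → ⟨ p , q ⟩ ≢ ⟨ x , y ⟩ → ¬ Sep p q x y
  ¬Sep {x} {y} x∼y p∼q e≢ S = 1+n≰n (≤-trans (s≥2 p∼q x∼y e≢ S S′)
    (≤-trans (s≤d x y) (≤-reflexive (adj⇒d≡1 x∼y))))
    where
    S′ : Sep x y x y
    S′ = subst₂ _<_ (sym (d-refl x)) (sym (adj⇒d≡1 (adj-sym G x∼y))) (s≤s z≤n)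
       , subst₂ _<_ (sym (d-refl y)) (sym (adj⇒d≡1 x∼y)) (s≤s z≤n)

  -- Along an edge of `T` the distances to `x` and to `y` both change, as it is never horizontal,
  -- and both in the same direction, as it does not separate `x` from `y`. Their difference is
  -- therefore preserved.
  parallel : ∀ {x y i j} → Adj G x y → Adj T i j → ⟨ g i , g j ⟩ ≢ ⟨ x , y ⟩ →
             d (g i) x ≡ suc (d (g i) y) → d (g j) x ≡ suc (d (g j) y)
  parallel {x} {y} {i} {j} x∼y e e≢ eq with <-cmp (d (g i) x) (d (g j) x) | <-cmp (d (g i) y) (d (g j) y)
  ... | tri≈ _ h _   | _            = contradiction h (¬Hor-T x e)
  ... | tri< _ _ _   | tri≈ _ h _   = contradiction h (¬Hor-T y e)
  ... | tri> _ _ _   | tri≈ _ h _   = contradiction h (¬Hor-T y e)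
  ... | tri< lt _ _  | tri> _ _ gt  = contradiction (lt , gt) (¬Sep x∼y e e≢)
  ... | tri> _ _ gt  | tri< lt _ _  = contradiction (gt , lt)
    (¬Sep x∼y (adj-sym G e) (e≢ ∘ trans (⟨⟩-comm (adj⇒≢ G e))))
  ... | tri< lt _ _  | tri< lt′ _ _ =
    trans (farther x e lt) (cong suc (trans eq (sym (farther y e lt′))))
  ... | tri> _ _ gt  | tri> _ _ gt′ = suc-injective
    (trans (sym (farther x (adj-sym G e) gt)) (trans eq (cong suc (farther y (adj-sym G e) gt′))))

  -- Along a cycle y = v₁, v₂, …, v₀ = x in T the difference d(vᵢ,x) − d(vᵢ,y) would
  -- be constantly 1, since only the edge xy separates x from y.
  T-acyclic : Acyclic T
  T-acyclic (suc (suc (suc k))) (s≤s (s≤s (s≤s z≤n))) (φ , φ-injective , φ-adj) =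
    Fin.0≢1+n (sym (Fin.suc-injective (φ-injective (g-injective last≡y))))
    where
    x y : Fin (2 + m)
    x = g (φ zero)
    y = g (φ (suc zero))

    x∼y : Adj G x y
    x∼y = φ-adj (inj₁ (inj₁ refl))

    constant : ∀ i → d (g (φ (suc i))) x ≡ suc (d (g (φ (suc i))) y)
    constant = <-weakInduction (λ i → d (g (φ (suc i))) x ≡ suc (d (g (φ (suc i))) y))
      (trans (adj⇒d≡1 (adj-sym G x∼y)) (cong suc (sym (d-refl y))))
      λ i → parallel x∼y (φ-adj (inj₁ (inj₁ (cong (_+_ 2) (sym (Fin.toℕ-inject₁ i)))))) (differ i)
      where
      differ : ∀ i → ⟨ g (φ (suc (inject₁ i))) , g (φ (suc (suc i))) ⟩ ≢ ⟨ x , y ⟩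
      differ i eq with ⟨⟩-injective eq
      ... | inj₁ (eq′ , _) with () ← φ-injective (g-injective eq′)
      ... | inj₂ (_ , eq′) with () ← φ-injective (g-injective eq′)

    last : Fin (3 + k)
    last = suc (fromℕ (suc k))

    last∼x : Adj G (g (φ last)) x
    last∼x = φ-adj (inj₁ (inj₂ (cong (_+_ 2) (Fin.toℕ-fromℕ (suc k)) , refl)))

    last≡y : g (φ last) ≡ y
    last≡y = d≡0⇒≡ (suc-injective (trans (sym (constant (fromℕ (suc k)))) (adj⇒d≡1 last∼x)))

  f : Fin 3 → Fin (2 + m)
  f zero             = a
  f (suc zero)       = b
  f (suc (suc zero)) = c

  f-adj : ∀ {i j} → i ≢ j → Adj G (f i) (f j)
  f-adj {zero}             {zero}             i≢j = contradiction refl i≢j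
  f-adj {zero}             {suc zero}         _   = a∼b
  f-adj {zero}             {suc (suc zero)}   _   = a∼c
  f-adj {suc zero}         {zero}             _   = adj-sym G a∼b
  f-adj {suc zero}         {suc zero}         i≢j = contradiction refl i≢j
  f-adj {suc zero}         {suc (suc zero)}   _   = b∼c
  f-adj {suc (suc zero)}   {zero}             _   = adj-sym G a∼c
  f-adj {suc (suc zero)}   {suc zero}         _   = adj-sym G b∼c
  f-adj {suc (suc zero)}   {suc (suc zero)}   i≢j = contradiction refl i≢j

  f-injective : Injective _≡_ _≡_ f
  f-injective {i} {j} eq with i Fin.≟ j
  ... | yes i≡j = i≡j
  ... | no  i≢j = contradiction eq (adj⇒≢ G (f-adj i≢j))

  triangleWithTree : IsTriangleWithTree G
  triangleWithTree = T , (T-connected , T-acyclic) , record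
    { f           = f
    ; g           = g
    ; f-injective = f-injective
    ; g-injective = g-injective
    ; vertices    = vertices
    ; shared      = c , ((suc (suc zero) , refl) , (c₀ , g-c₀)) , λ (i , j) → shared i j
    ; adjacency   = λ u v → mk⇔ split join
    }
    where
    vertices : ∀ v → (∃ λ i → f i ≡ v) ⊎ (∃ λ j → g j ≡ v)
    vertices v with v Fin.≟ a | v Fin.≟ b
    ... | yes refl | _        = inj₁ (zero , refl)
    ... | no  _    | yes refl = inj₁ (suc zero , refl)
    ... | no  v≢a  | no v≢b   = inj₂ (g-surjective v≢a v≢b)

    shared : ∀ {v} → (∃ λ i → f i ≡ v) → (∃ λ j → g j ≡ v) → c ≡ v
    shared (zero             , refl) (j , eq) = contradiction eq (g≢a j)
    shared (suc zero         , refl) (j , eq) = contradiction eq (g≢b j)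
    shared (suc (suc zero)   , refl) _        = refl

    triangle : ∀ i j → i ≢ j → ∀ {v} → f j ≡ v → ImageAdj C₃ f (f i) v
    triangle i j i≢j eq = i , j , refl , eq , C₃-complete i j i≢j

    split : ∀ {u v} → Adj G u v → ImageAdj C₃ f u v ⊎ ImageAdj T g u v
    split {u} {v} u∼v with u Fin.≟ a | u Fin.≟ b | v Fin.≟ a | v Fin.≟ b
    ... | yes refl | _        | _        | _        with nbr-a u∼v
    ...   | inj₁ eq = inj₁ (triangle zero (suc zero) (λ ()) (sym eq))
    ...   | inj₂ eq = inj₁ (triangle zero (suc (suc zero)) (λ ()) (sym eq))
    split {u} {v} u∼v | no _ | yes refl | _ | _ with nbr-b u∼v
    ...   | inj₁ eq = inj₁ (triangle (suc zero) zero (λ ()) (sym eq))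
    ...   | inj₂ eq = inj₁ (triangle (suc zero) (suc (suc zero)) (λ ()) (sym eq))
    split {u} {v} u∼v | no _ | no u≢b | yes refl | _ with nbr-a (adj-sym G u∼v)
    ...   | inj₁ eq   = contradiction eq u≢b
    ...   | inj₂ refl = inj₁ (triangle (suc (suc zero)) zero (λ ()) refl)
    split {u} {v} u∼v | no u≢a | no _ | no _ | yes refl with nbr-b (adj-sym G u∼v)
    ...   | inj₁ eq   = contradiction eq u≢a
    ...   | inj₂ refl = inj₁ (triangle (suc (suc zero)) (suc zero) (λ ()) refl)
    split {u} {v} u∼v | no u≢a | no u≢b | no v≢a | no v≢b =
      let i , gi≡u = g-surjective u≢a u≢b
          j , gj≡v = g-surjective v≢a v≢b
      in inj₂ (i , j , gi≡u , gj≡v , subst₂ (Adj G) (sym gi≡u) (sym gj≡v) u∼v)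

    join : ∀ {u v} → ImageAdj C₃ f u v ⊎ ImageAdj T g u v → Adj G u v
    join (inj₁ (i , j , refl , refl , e)) = f-adj (adj⇒≢ C₃ e)
    join (inj₂ (i , j , refl , refl , e)) = e

-- Bridges

module _ {n} {G : Graph n} where

  lookupʷ : ∀ {u v k} → Walk G u v k → Fin (suc k) → Fin n
  lookupʷ {u} _       zero    = u
  lookupʷ     (a ∷ p) (suc i) = lookupʷ p i

  takeʷ : ∀ {u v k} (p : Walk G u v k) i → Walk G u (lookupʷ p i) (toℕ i)
  takeʷ p       zero    = []
  takeʷ (a ∷ p) (suc i) = a ∷ takeʷ p i

  dropʷ : ∀ {u v k} (p : Walk G u v k) i → Walk G (lookupʷ p i) v (k ∸ toℕ i)
  dropʷ p       zero    = p
  dropʷ (a ∷ p) (suc i) = dropʷ p i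

  lookupʷ-adj : ∀ {u v k} (p : Walk G u v k) i j → toℕ j ≡ suc (toℕ i) → Adj G (lookupʷ p i) (lookupʷ p j)
  lookupʷ-adj (a ∷ [])      zero    (suc zero) refl = a
  lookupʷ-adj (a ∷ (_ ∷ _)) zero    (suc zero) refl = a
  lookupʷ-adj (a ∷ p)       (suc i) (suc j)    eq   = lookupʷ-adj p i j (suc-injective eq)

  lookupʷ-last : ∀ {u v k} (p : Walk G u v k) i → toℕ i ≡ k → lookupʷ p i ≡ v
  lookupʷ-last []      zero    _  = refl
  lookupʷ-last (a ∷ p) (suc i) eq = lookupʷ-last p i (suc-injective eq)

  -- Between two visits to the same vertex the walk could be cut short.
  shortest⇒lookupʷ-injective : ∀ {u v k} (p : Walk G u v k) → (∀ j → Walk G u v j → k ≤ j) →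
                               ∀ {i j} → lookupʷ p i ≡ lookupʷ p j → i ≡ j
  shortest⇒lookupʷ-injective {u} {v} {k} p min {i} {j} eq =
    Fin.toℕ-injective (≤-antisym (no-shortcut (sym eq)) (no-shortcut eq))
    where
    no-shortcut : ∀ {i j} → lookupʷ p i ≡ lookupʷ p j → toℕ j ≤ toℕ i
    no-shortcut {i} {j} eq = +-cancelʳ-≤ (k ∸ toℕ j) _ _ (≤-trans (≤-reflexive (m+[n∸m]≡n (Fin.toℕ≤pred[n] j)))
      (min _ (takeʷ p i ++ʷ subst (λ w → Walk G w v (k ∸ toℕ j)) (sym eq) (dropʷ p j))))

delete : ∀ {n} → Graph n → Fin n × Fin n → Graph n
delete G e = record
  { Adj    = λ x y → Adj G x y × ⟨ x , y ⟩ ≢ e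
  ; adj?   = λ x y → adj? G x y ×-dec ¬? (⟨ x , y ⟩ ≟ₑ e)
  ; sym    = λ (a , ≢e) → adj-sym G a , ≢e ∘ trans (⟨⟩-comm (adj⇒≢ G a))
  ; irrefl = λ { refl (a , _) → Graph.irrefl G refl a }
  }

Bridge : ∀ {n} → Graph n → Fin n → Fin n → Set
Bridge G u v = ¬ ∃ (Walk (delete G ⟨ u , v ⟩) u v)

-- A shortest walk from `u` to `v` that avoids the edge repeats no vertex, so together with the edge
-- it forms a cycle; lengths 0 and 1 are impossible.
acyclic⇒bridge : ∀ {n} (G : Graph n) → Acyclic G → ∀ {u v} → Adj G u v → Bridge G u v
acyclic⇒bridge G acyclic {u} {v} a w with least (walk? (delete G ⟨ u , v ⟩) u v) w
... | 0            , [] , _                  = Graph.irrefl G refl a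
... | 1            , ((_ , ≢e) ∷ []) , _     = ≢e refl
... | suc (suc k)  , p , min                 =
  acyclic (3 + k) (s≤s (s≤s (s≤s z≤n))) (lookupʷ p , shortest⇒lookupʷ-injective p min , Sum.[ next , adj-sym G ∘ next ])
  where
  next : ∀ {i j} → Next i j → Adj G (lookupʷ p i) (lookupʷ p j)
  next {i} {j}    (inj₁ eq)         = proj₁ (lookupʷ-adj p i j eq)
  -- The wrap-around from the last vertex `v` to the first vertex `u` is the deleted edge itself.
  next {i} {zero} (inj₂ (eq , _))   =
    subst (λ x → Adj G x u) (sym (lookupʷ-last p i (suc-injective eq))) (adj-sym G a)

module BridgeMetric {n} {G : Graph n} (d : Fin n → Fin n → ℕ)
                    (geodesic : ∀ u v → Least (Walk G u v) (d u v)) where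

  open Metric {G = G} d geodesic

  module _ {u v : Fin n} where

    private
      G-e : Graph n
      G-e = delete G ⟨ u , v ⟩

      -- A walk to `z` shorter than both distances from `u` and `v` can start at neither, and the
      -- same holds for its tails.
      avoid-far : ∀ {w z k} → Walk G w z k → k < d u z → k < d v z → Walk G-e w z k
      avoid-far []      _  _  = []
      avoid-far {w} {z} {suc k} (_∷_ {v = w′} a p) lu lv =
        (a , ≢e) ∷ avoid-far p (<-trans (n<1+n k) lu) (<-trans (n<1+n k) lv)
        where
        ≢e : ⟨ w , w′ ⟩ ≢ ⟨ u , v ⟩
        ≢e eq with ⟨⟩-injective eq
        ... | inj₁ (refl , _) = <⇒≱ lu (d-min (a ∷ p))
        ... | inj₂ (refl , _) = <⇒≱ lv (d-min (a ∷ p))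

      -- A geodesic from `u` cannot begin with `uv`, since `v` is no nearer to `z`; after its first
      -- edge it is too short to meet `u` or `v` again.
      avoidᵘ : ∀ {z k} → Walk G u z k → k ≡ d u z → d u z ≤ d v z → ∃ (Walk G-e u z)
      avoidᵘ []      _  _  = _ , []
      avoidᵘ {z} {suc k} (_∷_ {v = w′} a p) eq le =
        _ , (a , ≢e) ∷ avoid-far p (≤-reflexive eq) (≤-trans (≤-reflexive eq) le)
        where
        ≢e : ⟨ u , w′ ⟩ ≢ ⟨ u , v ⟩
        ≢e eq′ with ⟨⟩-cancelˡ eq′
        ... | refl = <⇒≱ (≤-trans (≤-reflexive eq) le) (d-min p)

      avoidᵛ : ∀ {z k} → Walk G v z k → k ≡ d v z → d v z ≤ d u z → ∃ (Walk G-e v z)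
      avoidᵛ []      _  _  = _ , []
      avoidᵛ {z} {suc k} (_∷_ {v = w′} a p) eq le =
        _ , (a , ≢e) ∷ avoid-far p (≤-trans (≤-reflexive eq) le) (≤-reflexive eq)
        where
        ≢e : ⟨ v , w′ ⟩ ≢ ⟨ u , v ⟩
        ≢e eq′ with ⟨⟩-injective eq′
        ... | inj₁ (refl , refl) = 1+n≰n (≤-trans (≤-reflexive eq) (d-min p))
        ... | inj₂ (_ , refl)    = <⇒≱ (≤-trans (≤-reflexive eq) le) (d-min p)

      from-u : ∀ {z} → d u z ≤ d v z → ∃ (Walk G-e u z)
      from-u = avoidᵘ (walk u _) refl

      from-v : ∀ {z} → d v z ≤ d u z → ∃ (Walk G-e v z)
      from-v = avoidᵛ (walk v _) refl

    module _ (bridge : Bridge G u v) where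

      -- From an equidistant `z` there are geodesics to both ends that avoid the edge, and they join
      -- into a detour.
      bridge⇒¬Hor : ∀ z → ¬ Hor u v z
      bridge⇒¬Hor z h =
        bridge (_ , proj₂ (from-u (≤-reflexive h)) ++ʷ reverseʷ (proj₂ (from-v (≤-reflexive (sym h)))))

      -- Another edge between the two sides would close a detour around the bridge.
      bridge⇒same-side : ∀ {z z′} → Adj G z z′ → ⟨ z , z′ ⟩ ≢ ⟨ u , v ⟩ → σ (u , v) z ≡ σ (u , v) z′
      bridge⇒same-side {z} {z′} a ≢e with <-cmp (d u z) (d v z) | <-cmp (d u z′) (d v z′)
      ... | tri≈ _ h _  | _            = contradiction h (bridge⇒¬Hor z)
      ... | tri< _ _ _  | tri≈ _ h _   = contradiction h (bridge⇒¬Hor z′)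
      ... | tri> _ _ _  | tri≈ _ h _   = contradiction h (bridge⇒¬Hor z′)
      ... | tri< lt _ _ | tri< lt′ _ _ = trans (side-< lt) (sym (side-< lt′))
      ... | tri> _ _ gt | tri> _ _ gt′ = trans (side-> gt) (sym (side-> gt′))
      ... | tri< lt _ _ | tri> _ _ gt′ = contradiction
        (_ , proj₂ (from-u (<⇒≤ lt)) ++ʷ (a , ≢e) ∷ reverseʷ (proj₂ (from-v (<⇒≤ gt′)))) bridge
      ... | tri> _ _ gt | tri< lt′ _ _ = contradiction
        (_ , proj₂ (from-u (<⇒≤ lt′)) ++ʷ (adj-sym G-e (a , ≢e)) ∷ reverseʷ (proj₂ (from-v (<⇒≤ gt)))) bridge

-- Graphs attaining the bound

module Apex
  {n} {G : Graph n} (d : Fin n → Fin n → ℕ) (geodesic : ∀ u v → Least (Walk G u v) (d u v))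
  {a b c : Fin n} (a∼b : Adj G a b) (b∼c : Adj G b c) (a∼c : Adj G a c)
  (nbr-a : ∀ {y} → Adj G a y → y ≡ b ⊎ y ≡ c) (nbr-b : ∀ {y} → Adj G b y → y ≡ a ⊎ y ≡ c) where

  open Metric {G = G} d geodesic

  -- A geodesic from `a` starts towards `c` or `b`. From `b` it could only return to `a` or go on to
  -- `c`, and `c` is adjacent to `a` anyway.
  d-apex : ∀ {x} → x ≢ a → x ≢ b → d a x ≡ suc (d c x)
  d-apex {x} x≢a x≢b with d a x in ax
  ... | zero = contradiction (sym (d≡0⇒≡ ax)) x≢a
  ... | suc k with firstStep ax
  ...   | w , a∼w , wx with nbr-a a∼w
  ...     | inj₂ refl = cong suc (sym wx)
  ...     | inj₁ refl with d b x in bx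
  ...       | zero = contradiction (sym (d≡0⇒≡ bx)) x≢b
  ...       | suc j with firstStep bx
  ...         | w′ , b∼w′ , w′x with nbr-b b∼w′
  ...           | inj₁ refl = contradiction
    (≤-trans (s≤s (≤-trans (n≤1+n j) (≤-reflexive wx))) (≤-reflexive (trans (sym ax) w′x))) 1+n≰n
  ...           | inj₂ refl = contradiction (d-step x a∼c)
    (<⇒≱ (≤-reflexive (trans (cong (_+_ 2) w′x) (trans (cong suc wx) (sym ax)))))

-- Treats the side `ac`; exchanging `a` and `b` turns it into the side `bc`.
module TriangleSide
  {n} {G : Graph n} (d : Fin n → Fin n → ℕ) (geodesic : ∀ u v → Least (Walk G u v) (d u v))
  {a b c : Fin n} (a∼b : Adj G a b) (b∼c : Adj G b c) (a∼c : Adj G a c)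
  (nbr-a : ∀ {y} → Adj G a y → y ≡ b ⊎ y ≡ c) (nbr-b : ∀ {y} → Adj G b y → y ≡ a ⊎ y ≡ c) where

  open Metric {G = G} d geodesic

  open Apex d geodesic a∼b b∼c a∼c nbr-a nbr-b public using (d-apex)
  open Apex d geodesic (adj-sym G a∼b) a∼c b∼c nbr-b nbr-a public using () renaming (d-apex to d-apexᵇ)

  σ-a : σ (a , c) a ≡ near
  σ-a = side-< (subst₂ _<_ (sym (d-refl a)) (sym (adj⇒d≡1 (adj-sym G a∼c))) (s≤s z≤n))

  σ-b : σ (a , c) b ≡ mid
  σ-b = side-≡ (trans (adj⇒d≡1 a∼b) (sym (adj⇒d≡1 (adj-sym G b∼c))))

  σ-rest : ∀ {x} → x ≢ a → x ≢ b → σ (a , c) x ≡ far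
  σ-rest {x} x≢a x≢b = side-> (≤-reflexive (sym (d-apex x≢a x≢b)))

  data Position (x : Fin n) : Set where
    at-a : x ≡ a → Position x
    at-b : x ≡ b → Position x
    rest : x ≢ a → x ≢ b → Position x

  position : ∀ x → Position x
  position x with x Fin.≟ a | x Fin.≟ b
  ... | yes x≡a | _       = at-a x≡a
  ... | no  _   | yes x≡b = at-b x≡b
  ... | no  x≢a | no  x≢b = rest x≢a x≢b

  -- Only `a` against a vertex outside {a, b} is separated by `ac`. A step towards the other one
  -- that changes the side would be `ac` itself or lead to `b`; the latter does not come nearer, as
  -- `c` is no farther from `a` than `b` is, and `a` no farther from the outer vertex than `b` is.
  sep-step : ∀ {x y y′} → d x y ≡ suc (d x y′) → Adj G y y′ → ⟨ y , y′ ⟩ ≢ ⟨ a , c ⟩ →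
             sep (σ (a , c) x) (σ (a , c) y) ≤ sep (σ (a , c) x) (σ (a , c) y′)
  sep-step {x} {y} {y′} eq y∼y′ ≢e with position x | position y
  ... | at-b refl    | _            = ≤-trans (≤-reflexive (cong (λ s → sep s (σ (a , c) y)) σ-b)) z≤n
  ... | at-a refl    | at-a refl    = ≤-trans (≤-reflexive (cong₂ sep σ-a σ-a)) z≤n
  ... | at-a refl    | at-b refl    = ≤-trans (≤-reflexive (cong₂ sep σ-a σ-b)) z≤n
  ... | rest x≢a x≢b | at-b refl    = ≤-trans (≤-reflexive (cong₂ sep (σ-rest x≢a x≢b) σ-b)) z≤n
  ... | rest x≢a x≢b | rest y≢a y≢b = ≤-trans (≤-reflexive (cong₂ sep (σ-rest x≢a x≢b) (σ-rest y≢a y≢b))) z≤n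
  ... | at-a refl    | rest y≢a y≢b with position y′
  ...   | rest y′≢a y′≢b = ≤-reflexive (cong (sep (σ (a , c) a)) (trans (σ-rest y≢a y≢b) (sym (σ-rest y′≢a y′≢b))))
  ...   | at-a refl with nbr-a (adj-sym G y∼y′)
  ...     | inj₁ y≡b  = contradiction y≡b y≢b
  ...     | inj₂ refl = contradiction (⟨⟩-comm (a≢c ∘ sym)) ≢e
    where
    a≢c : a ≢ c
    a≢c = adj⇒≢ G a∼c
  sep-step {x} {y} {y′} eq y∼y′ ≢e | at-a refl | rest y≢a y≢b | at-b refl with nbr-b (adj-sym G y∼y′)
  ...     | inj₁ y≡a  = contradiction y≡a y≢a
  ...     | inj₂ refl = contradiction (trans (sym (adj⇒d≡1 a∼c)) (trans eq (cong suc (adj⇒d≡1 a∼b)))) λ ()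
  sep-step {x} {y} {y′} eq y∼y′ ≢e | rest x≢a x≢b | at-a refl with nbr-a y∼y′
  ...     | inj₂ refl = contradiction refl ≢e
  ...     | inj₁ refl = contradiction
    (trans (sym (d-apexᵇ x≢b x≢a))
           (trans (d-sym b x) (suc-injective (trans (sym eq) (trans (d-sym x a) (d-apex x≢a x≢b))))))
    1+n≢n

module Attained
  {n} {G : Graph n} (d : Fin n → Fin n → ℕ) (geodesic : ∀ u v → Least (Walk G u v) (d u v))
  (¬bip : ¬ Bipartite G) {a b c : Fin n} (a∼b : Adj G a b) (b∼c : Adj G b c) (a∼c : Adj G a c)
  (nbr-a : ∀ {y} → Adj G a y → y ≡ b ⊎ y ≡ c) (nbr-b : ∀ {y} → Adj G b y → y ≡ a ⊎ y ≡ c)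
  (classify : ∀ {p q} → Adj G p q →
     Bridge G p q ⊎ ⟨ p , q ⟩ ≡ ⟨ a , b ⟩ ⊎ ⟨ p , q ⟩ ≡ ⟨ b , c ⟩ ⊎ ⟨ p , q ⟩ ≡ ⟨ a , c ⟩) where

  open Metric {G = G} d geodesic
  open LowerBound {G = G} d geodesic ¬bip
  open BridgeMetric {G = G} d geodesic
  open TriangleSide {G = G} d geodesic a∼b b∼c a∼c nbr-a nbr-b
  module Mirror = TriangleSide {G = G} d geodesic (adj-sym G a∼b) a∼c b∼c nbr-b nbr-a

  a≢b : a ≢ b
  a≢b = adj⇒≢ G a∼b

  Hor-ab : ∀ {x} → x ≢ a → x ≢ b → Hor a b x
  Hor-ab x≢a x≢b = trans (d-apex x≢a x≢b) (sym (d-apexᵇ x≢b x≢a))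

  -- The one horizontal edge of a vertex in the given position.
  opposite : ∀ {x} → Position x → Fin n × Fin n
  opposite (at-a _)   = ⟨ b , c ⟩
  opposite (at-b _)   = ⟨ a , c ⟩
  opposite (rest _ _) = ⟨ a , b ⟩

  ¬Hor-endˡ : ∀ {p q} → Adj G p q → ¬ Hor p q p
  ¬Hor-endˡ {p} p∼q h = adj⇒≢ G p∼q (sym (d≡0⇒≡ (trans (sym h) (d-refl p))))

  ¬Hor-endʳ : ∀ {p q} → Adj G p q → ¬ Hor p q q
  ¬Hor-endʳ {q = q} p∼q h = adj⇒≢ G p∼q (d≡0⇒≡ (trans h (d-refl q)))

  Hor⇒opposite : ∀ {p q x} (pos : Position x) → Adj G p q → Hor p q x → ⟨ p , q ⟩ ≡ opposite pos
  Hor⇒opposite {x = x} pos p∼q h with classify p∼q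
  ... | inj₁ bridge = contradiction h (bridge⇒¬Hor bridge x)
  Hor⇒opposite (at-a refl)    p∼q h | inj₂ (inj₁ eq)        = contradiction (Hor-⟨⟩ a eq h) (¬Hor-endˡ a∼b)
  Hor⇒opposite (at-a refl)    p∼q h | inj₂ (inj₂ (inj₁ eq)) = eq
  Hor⇒opposite (at-a refl)    p∼q h | inj₂ (inj₂ (inj₂ eq)) = contradiction (Hor-⟨⟩ a eq h) (¬Hor-endˡ a∼c)
  Hor⇒opposite (at-b refl)    p∼q h | inj₂ (inj₁ eq)        = contradiction (Hor-⟨⟩ b eq h) (¬Hor-endʳ a∼b)
  Hor⇒opposite (at-b refl)    p∼q h | inj₂ (inj₂ (inj₁ eq)) = contradiction (Hor-⟨⟩ b eq h) (¬Hor-endˡ b∼c)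
  Hor⇒opposite (at-b refl)    p∼q h | inj₂ (inj₂ (inj₂ eq)) = eq
  Hor⇒opposite (rest x≢a x≢b) p∼q h | inj₂ (inj₁ eq)        = eq
  Hor⇒opposite {x = x} (rest x≢a x≢b) p∼q h | inj₂ (inj₂ (inj₁ eq)) =
    contradiction (trans (sym (d-apexᵇ x≢b x≢a)) (Hor-⟨⟩ x eq h)) 1+n≢n
  Hor⇒opposite {x = x} (rest x≢a x≢b) p∼q h | inj₂ (inj₂ (inj₂ eq)) =
    contradiction (trans (sym (d-apex x≢a x≢b)) (Hor-⟨⟩ x eq h)) 1+n≢n

  z≤1 : ∀ {x y} (pos : Position x) (pos′ : Position y) → opposite pos ≡ opposite pos′ → z x y ≤ 1
  z≤1 {x} {y} pos pos′ opp≡ = ∑-Unique≤1 _ (opposite pos) (edges-Unique G) (λ e → hor≤1 (σ e x) (σ e y)) only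
    where
    only : ∀ {e} → e ∈ edges G → 1 ≤ hor (σ e x) (σ e y) → e ≡ opposite pos
    only {p , q} e∈ le with ∈edges⁻ G e∈ | hor≥1⇒mid (σ (p , q) x) (σ (p , q) y) le
    ... | p∼q , eq | inj₁ h = trans (sym eq) (Hor⇒opposite pos p∼q (mid⇒≡ h))
    ... | p∼q , eq | inj₂ h = trans (sym eq) (trans (Hor⇒opposite pos′ p∼q (mid⇒≡ h)) (sym opp≡))

  -- Majorant of the excess: 0 when the two vertices have the same horizontal edge, 1 otherwise.
  κ′ : ∀ {x y} → Position x → Position y → ℕ
  κ′ (at-a _)   (at-a _)   = 0
  κ′ (at-b _)   (at-b _)   = 0
  κ′ (rest _ _) (rest _ _) = 0
  κ′ _          _          = 1

  κ : Fin n → Fin n → ℕ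
  κ x y = κ′ (position x) (position y)

  z≤1+κ : ∀ x y → z x y ≤ 1 + κ x y
  z≤1+κ x y = bound (position x) (position y)
    where
    z≤2 : z x y ≤ 2
    z≤2 = ≤-trans (z≤+ x y) (+-mono-≤ (z≤1 (position x) (position x) refl) (z≤1 (position y) (position y) refl))

    bound : (pos : Position x) (pos′ : Position y) → z x y ≤ 1 + κ′ pos pos′
    bound pos@(at-a _)   pos′@(at-a _)   = z≤1 pos pos′ refl
    bound pos@(at-b _)   pos′@(at-b _)   = z≤1 pos pos′ refl
    bound pos@(rest _ _) pos′@(rest _ _) = z≤1 pos pos′ refl
    bound (at-a _)       (at-b _)        = z≤2
    bound (at-a _)       (rest _ _)      = z≤2
    bound (at-b _)       (at-a _)        = z≤2
    bound (at-b _)       (rest _ _)      = z≤2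
    bound (rest _ _)     (at-a _)        = z≤2
    bound (rest _ _)     (at-b _)        = z≤2

  SepStep : Fin n × Fin n → Fin n → Fin n → Fin n → Set
  SepStep e x y y′ = sep (σ e x) (σ e y) ≤ sep (σ e x) (σ e y′)

  SepStep-⟨⟩ : ∀ {p q x y y′} → SepStep (p , q) x y y′ → SepStep ⟨ p , q ⟩ x y y′
  SepStep-⟨⟩ {p} {q} {x} {y} {y′} = subst₂ _≤_ (sym (sep-⟨⟩ p q x y)) (sym (sep-⟨⟩ p q x y′))

  sep-step-ab : ∀ {x y y′} → d x y ≡ suc (d x y′) → ⟨ y , y′ ⟩ ≢ ⟨ a , b ⟩ → SepStep (a , b) x y y′
  sep-step-ab {x} {y} {y′} eq ≢e = step (position x) (position y)
    where
    σ-a′ : σ (a , b) a ≡ near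
    σ-a′ = side-< (subst₂ _<_ (sym (d-refl a)) (sym (adj⇒d≡1 (adj-sym G a∼b))) (s≤s z≤n))

    σ-b′ : σ (a , b) b ≡ far
    σ-b′ = side-> (subst₂ _<_ (sym (d-refl b)) (sym (adj⇒d≡1 a∼b)) (s≤s z≤n))

    x≡y′ : Adj G x y → x ≡ y′
    x≡y′ x∼y = d≡0⇒≡ (suc-injective (trans (sym eq) (adj⇒d≡1 x∼y)))

    zero-sep : ∀ {s t} → σ (a , b) x ≡ s → σ (a , b) y ≡ t → sep s t ≡ 0 → SepStep (a , b) x y y′
    zero-sep eq eq′ eq₀ = ≤-trans (≤-reflexive (trans (cong₂ sep eq eq′) eq₀)) z≤n

    step : Position x → Position y → SepStep (a , b) x y y′
    step (rest x≢a x≢b) _              = zero-sep (side-≡ (Hor-ab x≢a x≢b)) refl refl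
    step _              (rest y≢a y≢b) = zero-sep refl (side-≡ (Hor-ab y≢a y≢b)) (sep-comm _ mid)
    step (at-a refl)    (at-a refl)    = zero-sep σ-a′ σ-a′ refl
    step (at-b refl)    (at-b refl)    = zero-sep σ-b′ σ-b′ refl
    step (at-a refl)    (at-b refl)    with x≡y′ a∼b
    ... | refl = contradiction (⟨⟩-comm (a≢b ∘ sym)) ≢e
    step (at-b refl)    (at-a refl)    with x≡y′ (adj-sym G a∼b)
    ... | refl = contradiction refl ≢e

  edge-sep-step : ∀ {p q x y y′} → Adj G p q → d x y ≡ suc (d x y′) → Adj G y y′ →
                  ⟨ y , y′ ⟩ ≢ ⟨ p , q ⟩ → SepStep ⟨ p , q ⟩ x y y′
  edge-sep-step {p} {q} {x} {y} {y′} p∼q eq y∼y′ ≢e with classify p∼q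
  ... | inj₁ bridge =
    SepStep-⟨⟩ (≤-reflexive (cong (sep (σ (p , q) x)) (bridge⇒same-side bridge y∼y′ ≢e)))
  ... | inj₂ (inj₁ eq′)        = subst (λ e → SepStep e x y y′) (sym eq′)
    (SepStep-⟨⟩ (sep-step-ab eq (λ h → ≢e (trans h (sym eq′)))))
  ... | inj₂ (inj₂ (inj₁ eq′)) = subst (λ e → SepStep e x y y′) (sym eq′)
    (SepStep-⟨⟩ (Mirror.sep-step eq y∼y′ (λ h → ≢e (trans h (sym eq′)))))
  ... | inj₂ (inj₂ (inj₂ eq′)) = subst (λ e → SepStep e x y y′) (sym eq′)
    (SepStep-⟨⟩ (sep-step eq y∼y′ (λ h → ≢e (trans h (sym eq′)))))

  -- Every edge other than `yy′` that separates `x` from `y` still separates `x` from `y′`, so at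
  -- most one is lost.
  s-step : ∀ {x y y′} → d x y ≡ suc (d x y′) → Adj G y y′ → s x y ≤ s x y′ + 1
  s-step {x} {y} {y′} eq y∼y′ = begin
    s x y
      ≤⟨ ∑-mono (edges G) pointwise ⟩
    ∑[ e ∈ edges G ] (sep (σ e x) (σ e y′) + ⟦ e ≟ₑ ⟨ y , y′ ⟩ ⟧)
      ≡⟨ ∑-+ (edges G) _ _ ⟩
    s x y′ + ∑[ e ∈ edges G ] ⟦ e ≟ₑ ⟨ y , y′ ⟩ ⟧
      ≤⟨ +-monoʳ-≤ (s x y′) (∑-Unique≤1 _ ⟨ y , y′ ⟩ (edges-Unique G) ⟦⟧≤1 (λ {e} _ → 1≤⟦⟧ e)) ⟩
    s x y′ + 1 ∎
    where
    open ≤-Reasoning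

    ⟦⟧≤1 : ∀ e → ⟦ e ≟ₑ ⟨ y , y′ ⟩ ⟧ ≤ 1
    ⟦⟧≤1 e with e ≟ₑ ⟨ y , y′ ⟩
    ... | yes _ = ≤-refl
    ... | no  _ = z≤n

    1≤⟦⟧ : ∀ e → 1 ≤ ⟦ e ≟ₑ ⟨ y , y′ ⟩ ⟧ → e ≡ ⟨ y , y′ ⟩
    1≤⟦⟧ e le with e ≟ₑ ⟨ y , y′ ⟩
    ... | yes eq = eq

    pointwise : ∀ {e} → e ∈ edges G → sep (σ e x) (σ e y) ≤ sep (σ e x) (σ e y′) + ⟦ e ≟ₑ ⟨ y , y′ ⟩ ⟧
    pointwise {p , q} e∈ with (p , q) ≟ₑ ⟨ y , y′ ⟩ | ∈edges⁻ G e∈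
    ... | yes _  | _         = ≤-trans (sep≤1 (σ (p , q) x) (σ (p , q) y)) (m≤n+m 1 _)
    ... | no  ≢e | p∼q , eq′ = ≤-trans
      (subst (λ e → SepStep e x y y′) eq′ (edge-sep-step p∼q eq y∼y′ (λ h → ≢e (trans (sym eq′) (sym h)))))
      (m≤m+n _ 0)

  s≤d : ∀ x y → s x y ≤ d x y
  s≤d x y = bound (d x y) refl
    where
    sep-diag : ∀ t → sep t t ≡ 0
    sep-diag near = refl
    sep-diag mid  = refl
    sep-diag far  = refl

    bound : ∀ k {y} → d x y ≡ k → s x y ≤ k
    bound zero    eq with d≡0⇒≡ eq
    ... | refl = ≤-reflexive (∑-zero (edges G) λ {e} _ → sep-diag (σ e x))
    bound (suc k) {y} eq =
      let y′ , y∼y′ , y′x = firstStep (trans (d-sym y x) eq)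
          xy′             = trans (d-sym x y′) y′x
      in ≤-trans (s-step (trans eq (cong suc (sym xy′))) y∼y′)
                 (≤-trans (+-monoˡ-≤ 1 (bound k xy′)) (≤-reflexive (+-comm k 1)))

  δ≤κ : ∀ x y → δ x y ≤ κ x y
  δ≤κ x y = m≤n+o⇒m∸n≤o _ (1 + 2 * d x y) (begin
    2 * s x y + z x y            ≤⟨ +-mono-≤ (*-monoʳ-≤ 2 (s≤d x y)) (z≤1+κ x y) ⟩
    2 * d x y + (1 + κ x y)      ≡⟨ +-suc _ _ ⟩
    1 + 2 * d x y + κ x y        ∎)
    where open ≤-Reasoning

  κ-comm : ∀ x y → κ x y ≡ κ y x
  κ-comm x y = comm (position x) (position y)
    where
    comm : (pos : Position x) (pos′ : Position y) → κ′ pos pos′ ≡ κ′ pos′ pos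
    comm (at-a _)   (at-a _)   = refl
    comm (at-a _)   (at-b _)   = refl
    comm (at-a _)   (rest _ _) = refl
    comm (at-b _)   (at-a _)   = refl
    comm (at-b _)   (at-b _)   = refl
    comm (at-b _)   (rest _ _) = refl
    comm (rest _ _) (at-a _)   = refl
    comm (rest _ _) (at-b _)   = refl
    comm (rest _ _) (rest _ _) = refl

  ∑δ≤ : 6 + ∑δ ≤ 4 * n
  ∑δ≤ =
    let ws , p = allFin↭∷∷∷ a≢b (adj⇒≢ G b∼c) (adj⇒≢ G a∼c)
    in ≤-trans (+-monoʳ-≤ 6 (∑-mono (allFin n) λ {x} _ → ∑-mono (allFin n) λ {y} _ → δ≤κ x y))
               (Transversal.6+total≤4n κ κ-comm a b c ws p
                 (λ y → κ-column (position a) (position b) (position c) (position y))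
                 λ x∈ y∈ → κ-rest (position _) (position _) (avoids p x∈) (avoids p y∈))
    where
    -- Exactly one of `a`, `b`, `c` lies in the class of `y`; the other two contribute 1 each.
    κ-column : ∀ {y} (pa : Position a) (pb : Position b) (pc : Position c) (py : Position y) →
               κ′ pa py + κ′ pb py + κ′ pc py ≤ 2
    κ-column (at-b eq)   _           _           _          = contradiction eq a≢b
    κ-column (rest ≢a _) _           _           _          = contradiction refl ≢a
    κ-column (at-a _)    (at-a eq)   _           _          = contradiction (sym eq) a≢b
    κ-column (at-a _)    (rest _ ≢b) _           _          = contradiction refl ≢b
    κ-column (at-a _)    (at-b _)    (at-a eq)   _          = contradiction (sym eq) (adj⇒≢ G a∼c)
    κ-column (at-a _)    (at-b _)    (at-b eq)   _          = contradiction (sym eq) (adj⇒≢ G b∼c)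
    κ-column (at-a _)    (at-b _)    (rest _ _)  (at-a _)   = ≤-refl
    κ-column (at-a _)    (at-b _)    (rest _ _)  (at-b _)   = ≤-refl
    κ-column (at-a _)    (at-b _)    (rest _ _)  (rest _ _) = ≤-refl

    κ-rest : ∀ {x y} (px : Position x) (py : Position y) → x ≢ a × x ≢ b → y ≢ a × y ≢ b → κ′ px py ≡ 0
    κ-rest (at-a eq)  _          (≢a , _) _        = contradiction eq ≢a
    κ-rest (at-b eq)  _          (_ , ≢b) _        = contradiction eq ≢b
    κ-rest (rest _ _) (at-a eq)  _        (≢a , _) = contradiction eq ≢a
    κ-rest (rest _ _) (at-b eq)  _        (_ , ≢b) = contradiction eq ≢b
    κ-rest (rest _ _) (rest _ _) _        _        = refl

    avoids : ∀ {ws x} → allFin n ↭ a ∷ b ∷ c ∷ ws → x ∈ ws → x ≢ a × x ≢ b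
    avoids {ws} {x} p x∈ with Unique-resp-↭ (setoid (Fin n)) (↭⇒↭ₛ p) (Unique.allFin⁺ n)
    ... | a∉ ∷ b∉ ∷ _ = lookupAll a∉ (there (there x∈)) ∘ sym , lookupAll b∉ (there x∈) ∘ sym

module FromUnion
  {n q} {G : Graph n} {T : Graph q} (d : Fin n → Fin n → ℕ) (geodesic : ∀ u v → Least (Walk G u v) (d u v))
  (¬bip : ¬ Bipartite G) (acyclic : Acyclic T) (union : IsUnionSharingVertex G C₃ T) where

  open IsUnionSharingVertex union

  c : Fin n
  c = proj₁ shared

  k₀ : Fin 3
  k₀ = proj₁ (proj₁ (proj₁ (proj₂ shared)))

  f-k₀ : f k₀ ≡ c
  f-k₀ = proj₂ (proj₁ (proj₁ (proj₂ shared)))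

  c₀ : Fin q
  c₀ = proj₁ (proj₂ (proj₁ (proj₂ shared)))

  g-c₀ : g c₀ ≡ c
  g-c₀ = proj₂ (proj₂ (proj₁ (proj₂ shared)))

  common : ∀ i j → f i ≡ g j → i ≡ k₀ × j ≡ c₀
  common i j eq =
    let c≡fi = proj₂ (proj₂ shared) ((i , refl) , (j , sym eq))
    in f-injective (trans (sym c≡fi) (sym f-k₀)) , g-injective (trans (sym eq) (trans (sym c≡fi) (sym g-c₀)))

  -- Collapses the triangle to the shared vertex. `vertices` may report that vertex on either side;
  -- `ρ-f` and `ρ-g` show that both answers agree.
  ρ : Fin n → Fin q
  ρ v with vertices v
  ... | inj₁ _       = c₀
  ... | inj₂ (j , _) = j

  ρ-f : ∀ i → ρ (f i) ≡ c₀
  ρ-f i with vertices (f i)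
  ... | inj₁ _        = refl
  ... | inj₂ (j , eq) = proj₂ (common i j (sym eq))

  ρ-g : ∀ j → ρ (g j) ≡ j
  ρ-g j with vertices (g j)
  ... | inj₁ (i , eq)  = sym (proj₂ (common i j eq))
  ... | inj₂ (j′ , eq) = g-injective eq

  -- A detour in `G` collapses to a detour in `T`, because triangle edges are contracted and other
  -- tree edges are kept.
  tree-bridge : ∀ {i j} → Adj T i j → Bridge G (g i) (g j)
  tree-bridge {i} {j} i∼j (_ , p) =
    acyclic⇒bridge T acyclic i∼j
      (subst₂ (λ i′ j′ → ∃ (Walk (delete T ⟨ i , j ⟩) i′ j′)) (ρ-g i) (ρ-g j)
        (collapseʷ {G = delete G ⟨ g i , g j ⟩} {H = delete T ⟨ i , j ⟩} ρ ρ-adj p))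
    where
    ⟨⟩-g : ∀ {i′ j′} → ⟨ i′ , j′ ⟩ ≡ ⟨ i , j ⟩ → ⟨ g i′ , g j′ ⟩ ≡ ⟨ g i , g j ⟩
    ⟨⟩-g eq with ⟨⟩-injective eq
    ... | inj₁ (refl , refl) = refl
    ... | inj₂ (refl , refl) = ⟨⟩-comm (λ eq → adj⇒≢ T i∼j (sym (g-injective eq)))

    ρ-adj : ∀ {u v} → Adj (delete G ⟨ g i , g j ⟩) u v → ρ u ≡ ρ v ⊎ Adj (delete T ⟨ i , j ⟩) (ρ u) (ρ v)
    ρ-adj {u} {v} (u∼v , ≢e) with Equivalence.to (adjacency u v) u∼v
    ... | inj₁ (i′ , j′ , refl , refl , _) = inj₁ (trans (ρ-f i′) (sym (ρ-f j′)))
    ... | inj₂ (i′ , j′ , refl , refl , e) = inj₂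
      (subst₂ (Adj (delete T ⟨ i , j ⟩)) (sym (ρ-g i′)) (sym (ρ-g j′)) (e , ≢e ∘ ⟨⟩-g))

  f-adj : ∀ {i j} → i ≢ j → Adj G (f i) (f j)
  f-adj {i} {j} i≢j = Equivalence.from (adjacency _ _) (inj₁ (i , j , refl , refl , C₃-complete i j i≢j))

  -- Any vertex of the triangle may be the shared one; `i` and `j` name the two others.
  module _ (i j : Fin 3) (i≢j : i ≢ j) (j≢k : j ≢ k₀) (i≢k : i ≢ k₀)
           (all : ∀ l → l ≡ i ⊎ l ≡ j ⊎ l ≡ k₀) where

    nbr : ∀ {l y} → l ≢ k₀ → Adj G (f l) y → ∃ λ l′ → f l′ ≡ y × l′ ≢ l
    nbr {l} {y} l≢k l∼y with Equivalence.to (adjacency (f l) y) l∼y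
    ... | inj₁ (l₁ , l′ , eq , eq′ , e) = l′ , eq′ , λ l′≡l → adj⇒≢ C₃ e (trans (f-injective eq) (sym l′≡l))
    ... | inj₂ (i′ , _ , eq , _ , _)    = contradiction (proj₁ (common l i′ (sym eq))) l≢k

    nbr-i : ∀ {y} → Adj G (f i) y → y ≡ f j ⊎ y ≡ f k₀
    nbr-i i∼y with nbr i≢k i∼y
    ... | l , refl , l≢i with all l
    ...   | inj₁ l≡i         = contradiction l≡i l≢i
    ...   | inj₂ (inj₁ refl) = inj₁ refl
    ...   | inj₂ (inj₂ refl) = inj₂ refl

    nbr-j : ∀ {y} → Adj G (f j) y → y ≡ f i ⊎ y ≡ f k₀
    nbr-j j∼y with nbr j≢k j∼y
    ... | l , refl , l≢j with all l
    ...   | inj₁ refl        = inj₁ refl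
    ...   | inj₂ (inj₁ l≡j)  = contradiction l≡j l≢j
    ...   | inj₂ (inj₂ refl) = inj₂ refl

    triangle-edge : ∀ l l′ → l ≢ l′ →
      ⟨ f l , f l′ ⟩ ≡ ⟨ f i , f j ⟩ ⊎ ⟨ f l , f l′ ⟩ ≡ ⟨ f j , f k₀ ⟩ ⊎ ⟨ f l , f l′ ⟩ ≡ ⟨ f i , f k₀ ⟩
    triangle-edge l l′ l≢l′ with all l | all l′
    ... | inj₁ refl        | inj₁ refl        = contradiction refl l≢l′
    ... | inj₁ refl        | inj₂ (inj₁ refl) = inj₁ refl
    ... | inj₁ refl        | inj₂ (inj₂ refl) = inj₂ (inj₂ refl)
    ... | inj₂ (inj₁ refl) | inj₁ refl        = inj₁ (⟨⟩-comm (l≢l′ ∘ f-injective))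
    ... | inj₂ (inj₁ refl) | inj₂ (inj₁ refl) = contradiction refl l≢l′
    ... | inj₂ (inj₁ refl) | inj₂ (inj₂ refl) = inj₂ (inj₁ refl)
    ... | inj₂ (inj₂ refl) | inj₁ refl        = inj₂ (inj₂ (⟨⟩-comm (l≢l′ ∘ f-injective)))
    ... | inj₂ (inj₂ refl) | inj₂ (inj₁ refl) = inj₂ (inj₁ (⟨⟩-comm (l≢l′ ∘ f-injective)))
    ... | inj₂ (inj₂ refl) | inj₂ (inj₂ refl) = contradiction refl l≢l′

    classify : ∀ {u v} → Adj G u v → Bridge G u v ⊎
      ⟨ u , v ⟩ ≡ ⟨ f i , f j ⟩ ⊎ ⟨ u , v ⟩ ≡ ⟨ f j , f k₀ ⟩ ⊎ ⟨ u , v ⟩ ≡ ⟨ f i , f k₀ ⟩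
    classify {u} {v} u∼v with Equivalence.to (adjacency u v) u∼v
    ... | inj₁ (l , l′ , refl , refl , e) = inj₂ (triangle-edge l l′ (adj⇒≢ C₃ e))
    ... | inj₂ (_ , _ , refl , refl , e)  = inj₁ (tree-bridge e)

    attained : 6 + LowerBound.∑δ {G = G} d geodesic ¬bip ≤ 4 * n
    attained = Attained.∑δ≤ {G = G} d geodesic ¬bip (f-adj i≢j) (f-adj j≢k) (f-adj i≢k) nbr-i nbr-j classify

  ∑δ-attained : 6 + LowerBound.∑δ {G = G} d geodesic ¬bip ≤ 4 * n
  ∑δ-attained =
    let i , j , i≢j , j≢k , i≢k , all = others k₀ in attained i j i≢j j≢k i≢k all
    where
    others : ∀ k → ∃₂ λ (i j : Fin 3) → i ≢ j × j ≢ k × i ≢ k × (∀ l → l ≡ i ⊎ l ≡ j ⊎ l ≡ k)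
    others zero = suc zero , suc (suc zero) , (λ ()) , (λ ()) , (λ ()) , λ where
      zero             → inj₂ (inj₂ refl)
      (suc zero)       → inj₁ refl
      (suc (suc zero)) → inj₂ (inj₁ refl)
    others (suc zero) = zero , suc (suc zero) , (λ ()) , (λ ()) , (λ ()) , λ where
      zero             → inj₁ refl
      (suc zero)       → inj₂ (inj₂ refl)
      (suc (suc zero)) → inj₂ (inj₁ refl)
    others (suc (suc zero)) = zero , suc zero , (λ ()) , (λ ()) , (λ ()) , λ where
      zero             → inj₁ refl
      (suc zero)       → inj₂ (inj₁ refl)
      (suc (suc zero)) → inj₂ (inj₂ refl)

-- Passage to the rational indices

-- With a literal denominator, `_/_` is by definition the image under `fromℚᵘ` of an unnormalised
-- fraction, so computing there reduces each identity to one between integers.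
fromℚᵘ-+ : ∀ p q → fromℚᵘ p ℚ.+ fromℚᵘ q ≡ fromℚᵘ (p ℚᵘ.+ q)
fromℚᵘ-+ p q = ℚ.toℚᵘ-injective (ℚᵘ.≃-trans (ℚ.toℚᵘ-homo-+ (fromℚᵘ p) (fromℚᵘ q))
  (ℚᵘ.≃-trans (ℚᵘ.+-cong (ℚ.toℚᵘ-fromℚᵘ p) (ℚ.toℚᵘ-fromℚᵘ q)) (ℚᵘ.≃-sym (ℚ.toℚᵘ-fromℚᵘ (p ℚᵘ.+ q)))))

fromℚᵘ-* : ∀ p q → fromℚᵘ p ℚ.* fromℚᵘ q ≡ fromℚᵘ (p ℚᵘ.* q)
fromℚᵘ-* p q = ℚ.toℚᵘ-injective (ℚᵘ.≃-trans (ℚ.toℚᵘ-homo-* (fromℚᵘ p) (fromℚᵘ q))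
  (ℚᵘ.≃-trans (ℚᵘ.*-cong (ℚ.toℚᵘ-fromℚᵘ p) (ℚ.toℚᵘ-fromℚᵘ q)) (ℚᵘ.≃-sym (ℚ.toℚᵘ-fromℚᵘ (p ℚᵘ.* q)))))

fromℚᵘ-mono-≤ : ∀ {p q} → p ℚᵘ.≤ q → fromℚᵘ p ℚ.≤ fromℚᵘ q
fromℚᵘ-mono-≤ {p} {q} p≤q = ℚ.toℚᵘ-cancel-≤
  (ℚᵘ.≤-respˡ-≃ (ℚᵘ.≃-sym (ℚ.toℚᵘ-fromℚᵘ p)) (ℚᵘ.≤-respʳ-≃ (ℚᵘ.≃-sym (ℚ.toℚᵘ-fromℚᵘ q)) p≤q))

+/4-mono-≤ : ∀ {m k} → m ≤ k → + m / 4 ℚ.≤ + k / 4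
+/4-mono-≤ {m} {k} m≤k = fromℚᵘ-mono-≤ {mkℚᵘ (+ m) 3} {mkℚᵘ (+ k) 3} (*≤* (ℤ.*-monoʳ-≤-nonNeg (+ 4) (ℤ.+≤+ m≤k)))

+/4-injective : ∀ {m k} → + m / 4 ≡ + k / 4 → m ≡ k
+/4-injective {m} {k} eq with ℚ.fromℚᵘ-injective {mkℚᵘ (+ m) 3} {mkℚᵘ (+ k) 3} eq
... | *≡* eq′ = ℤ.+-injective (ℤ.*-cancelʳ-≡ (+ m) (+ k) (+ 4) eq′)

+/4-+ : ∀ m k → + m / 4 ℚ.+ + k / 4 ≡ + (m + k) / 4
+/4-+ m k = trans (fromℚᵘ-+ (mkℚᵘ (+ m) 3) (mkℚᵘ (+ k) 3))
  (ℚ.fromℚᵘ-cong {mkℚᵘ (+ m) 3 ℚᵘ.+ mkℚᵘ (+ k) 3} {mkℚᵘ (+ (m + k)) 3} (*≡* (begin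
  (+ m ℤ.* + 4 ℤ.+ + k ℤ.* + 4) ℤ.* + 4
    ≡⟨ solve 2 (λ m k → (m :* con (+ 4) :+ k :* con (+ 4)) :* con (+ 4) := (m :+ k) :* con (+ 16)) refl (+ m) (+ k) ⟩
  (+ m ℤ.+ + k) ℤ.* + 16                  ≡⟨ cong (ℤ._* + 16) (ℤ.pos-+ m k) ⟨
  + (m + k) ℤ.* + 16                      ∎)))
  where
  open ≡-Reasoning
  open ℤ-Solver.+-*-Solver

+/4-shift : ∀ m k → + (m + 4 * k) / 4 - + k / 1 ≡ + m / 4
+/4-shift m k = begin
  + (m + 4 * k) / 4 - + k / 1               ≡⟨ cong (ℚ._- + k / 1) split ⟩
  + m / 4 ℚ.+ + k / 1 - + k / 1             ≡⟨ ℚ.+-assoc (+ m / 4) (+ k / 1) (ℚ.- (+ k / 1)) ⟩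
  + m / 4 ℚ.+ (+ k / 1 - + k / 1)           ≡⟨ cong (+ m / 4 ℚ.+_) (ℚ.+-inverseʳ (+ k / 1)) ⟩
  + m / 4 ℚ.+ ℚ.0ℚ                          ≡⟨ ℚ.+-identityʳ (+ m / 4) ⟩
  + m / 4                                   ∎
  where
  open ≡-Reasoning
  open ℤ-Solver.+-*-Solver

  split : + (m + 4 * k) / 4 ≡ + m / 4 ℚ.+ + k / 1
  split = sym (trans (fromℚᵘ-+ (mkℚᵘ (+ m) 3) (mkℚᵘ (+ k) 0))
    (ℚ.fromℚᵘ-cong {mkℚᵘ (+ m) 3 ℚᵘ.+ mkℚᵘ (+ k) 0} {mkℚᵘ (+ (m + 4 * k)) 3} (*≡* (begin
    (+ m ℤ.* + 1 ℤ.+ + k ℤ.* + 4) ℤ.* + 4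
      ≡⟨ solve 2 (λ m k → (m :* con (+ 1) :+ k :* con (+ 4)) :* con (+ 4)
                       := (m :+ con (+ 4) :* k) :* con (+ 4)) refl (+ m) (+ k) ⟩
    (+ m ℤ.+ + 4 ℤ.* + k) ℤ.* + 4           ≡⟨ cong (λ i → (+ m ℤ.+ i) ℤ.* + 4) (ℤ.pos-* 4 k) ⟨
    (+ m ℤ.+ + (4 * k)) ℤ.* + 4             ≡⟨ cong (ℤ._* + 4) (ℤ.pos-+ m (4 * k)) ⟨
    + (m + 4 * k) ℤ.* + 4                   ∎))))

half-product : ∀ c c′ e → (+ c / 1 ℚ.+ + e / 2) ℚ.* (+ c′ / 1 ℚ.+ + e / 2) ≡ + ((2 * c + e) * (2 * c′ + e)) / 4
half-product c c′ e = begin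
  (+ c / 1 ℚ.+ + e / 2) ℚ.* (+ c′ / 1 ℚ.+ + e / 2)
    ≡⟨ cong₂ ℚ._*_ (fromℚᵘ-+ (mkℚᵘ (+ c) 0) (mkℚᵘ (+ e) 1)) (fromℚᵘ-+ (mkℚᵘ (+ c′) 0) (mkℚᵘ (+ e) 1)) ⟩
  fromℚᵘ (mkℚᵘ (+ c) 0 ℚᵘ.+ mkℚᵘ (+ e) 1) ℚ.* fromℚᵘ (mkℚᵘ (+ c′) 0 ℚᵘ.+ mkℚᵘ (+ e) 1)
    ≡⟨ fromℚᵘ-* (mkℚᵘ (+ c) 0 ℚᵘ.+ mkℚᵘ (+ e) 1) (mkℚᵘ (+ c′) 0 ℚᵘ.+ mkℚᵘ (+ e) 1) ⟩
  fromℚᵘ ((mkℚᵘ (+ c) 0 ℚᵘ.+ mkℚᵘ (+ e) 1) ℚᵘ.* (mkℚᵘ (+ c′) 0 ℚᵘ.+ mkℚᵘ (+ e) 1))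
    ≡⟨ ℚ.fromℚᵘ-cong {(mkℚᵘ (+ c) 0 ℚᵘ.+ mkℚᵘ (+ e) 1) ℚᵘ.* (mkℚᵘ (+ c′) 0 ℚᵘ.+ mkℚᵘ (+ e) 1)}
                     {mkℚᵘ (+ ((2 * c + e) * (2 * c′ + e))) 3} (*≡* (cong (ℤ._* + 4) numerator)) ⟩
  + ((2 * c + e) * (2 * c′ + e)) / 4 ∎
  where
  open ≡-Reasoning
  open ℤ-Solver.+-*-Solver

  pos-2*+ : ∀ k → + (2 * k + e) ≡ + 2 ℤ.* + k ℤ.+ + e
  pos-2*+ k = trans (ℤ.pos-+ (2 * k) e) (cong (ℤ._+ + e) (ℤ.pos-* 2 k))

  numerator : (+ c ℤ.* + 2 ℤ.+ + e ℤ.* + 1) ℤ.* (+ c′ ℤ.* + 2 ℤ.+ + e ℤ.* + 1) ≡ + ((2 * c + e) * (2 * c′ + e))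
  numerator = begin
    (+ c ℤ.* + 2 ℤ.+ + e ℤ.* + 1) ℤ.* (+ c′ ℤ.* + 2 ℤ.+ + e ℤ.* + 1)
      ≡⟨ solve 3 (λ c c′ e → (c :* con (+ 2) :+ e :* con (+ 1)) :* (c′ :* con (+ 2) :+ e :* con (+ 1))
           := (con (+ 2) :* c :+ e) :* (con (+ 2) :* c′ :+ e)) refl (+ c) (+ c′) (+ e) ⟩
    (+ 2 ℤ.* + c ℤ.+ + e) ℤ.* (+ 2 ℤ.* + c′ ℤ.+ + e)
      ≡⟨ cong₂ ℤ._*_ (pos-2*+ c) (pos-2*+ c′) ⟨
    + (2 * c + e) ℤ.* + (2 * c′ + e)
      ≡⟨ ℤ.pos-* (2 * c + e) (2 * c′ + e) ⟨
    + ((2 * c + e) * (2 * c′ + e)) ∎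

sumℚ-/4 : (xs : List A) (t : A → ℚ) (k : A → ℕ) → (∀ x → t x ≡ + k x / 4) →
          sumℚ (map t xs) ≡ + ∑ xs k / 4
sumℚ-/4 []       t k eq = refl
sumℚ-/4 (x ∷ xs) t k eq = trans (cong₂ ℚ._+_ (eq x) (sumℚ-/4 xs t k eq)) (+/4-+ (k x) (∑ xs k))

2*∑-pairs : ∀ {n} (f : Fin n → Fin n → ℕ) → (∀ u v → f u v ≡ f v u) → (∀ u → f u u ≡ 0) →
            2 * (∑[ e ∈ pairs n ] f (proj₁ e) (proj₂ e)) ≡ ∑[ u ∈ allFin n ] ∑[ v ∈ allFin n ] f u v
2*∑-pairs {n} f f-comm f-diag = begin
  2 * P                                                           ≡⟨ cong (λ k → P + k) (+-identityʳ P) ⟩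
  P + P                                                           ≡⟨ cong₂ _+_ P≡ (trans P≡ (∑-swap V V _)) ⟩
  (∑[ u ∈ V ] ∑[ v ∈ V ] L u v) + (∑[ u ∈ V ] ∑[ v ∈ V ] L v u)   ≡⟨ ∑-+ V _ _ ⟨
  ∑[ u ∈ V ] ((∑[ v ∈ V ] L u v) + (∑[ v ∈ V ] L v u))
    ≡⟨ ∑-cong V (λ u → trans (sym (∑-+ V (L u) (λ v → L v u))) (∑-cong V (pointwise u))) ⟩
  ∑[ u ∈ V ] ∑[ v ∈ V ] f u v                                     ∎
  where
  open ≡-Reasoning

  V : List (Fin n)
  V = allFin n

  P : ℕ
  P = ∑[ e ∈ pairs n ] f (proj₁ e) (proj₂ e)

  L : Fin n → Fin n → ℕ
  L u v = ⟦ u Fin.<? v ⟧ * f u v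

  P≡ : P ≡ ∑[ u ∈ V ] ∑[ v ∈ V ] L u v
  P≡ = trans (∑-filter (λ (u , v) → u Fin.<? v) (cartesianProduct V V) (λ (u , v) → f u v)) (∑-cartesianProduct V V _)

  pointwise : ∀ u v → L u v + L v u ≡ f u v
  pointwise u v with Fin.<-cmp u v
  ... | tri< lt _ gt = trans (cong₂ (λ i j → i * f u v + j * f v u) (⟦⟧-yes (u Fin.<? v) lt) (⟦⟧-no (v Fin.<? u) gt))
                             (trans (+-identityʳ _) (+-identityʳ _))
  ... | tri≈ lt refl _ = trans (cong₂ (λ i j → i * f u u + j * f u u) (⟦⟧-no (u Fin.<? u) lt) (⟦⟧-no (u Fin.<? u) lt))
                               (sym (f-diag u))
  ... | tri> lt _ gt = trans (cong₂ (λ i j → i * f u v + j * f v u) (⟦⟧-no (u Fin.<? v) lt) (⟦⟧-yes (v Fin.<? u) gt))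
                             (trans (+-identityʳ _) (f-comm v u))

-- Twice the contribution of a vertex to n_u + n_0/2; composed with `opp`, to n_v + n_0/2.
weight : Side → ℕ
weight near = 2
weight mid  = 1
weight far  = 0

weight-side : ∀ m k → 2 * ⟦ m <? k ⟧ + ⟦ m ≟ k ⟧ ≡ weight (side m k)
weight-side m k with <-cmp m k
... | tri< lt ne gt = trans (cong₂ (λ i j → 2 * i + j) (⟦⟧-yes (m <? k) lt) (⟦⟧-no (m ≟ k) ne))
                      (cong weight (sym (side-< lt)))
... | tri≈ lt eq gt = trans (cong₂ (λ i j → 2 * i + j) (⟦⟧-no (m <? k) lt) (⟦⟧-yes (m ≟ k) eq))
                      (cong weight (sym (side-≡ eq)))
... | tri> lt ne gt = trans (cong₂ (λ i j → 2 * i + j) (⟦⟧-no (m <? k) lt) (⟦⟧-no (m ≟ k) ne))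
                      (cong weight (sym (side-> gt)))

-- Only the sum over both orders is symmetric: for `near` and `far` the single products are 4 and 0.
weight-product : ∀ a b → weight a * weight (opp b) + weight b * weight (opp a) ≡ 2 * (2 * sep a b + hor a b)
weight-product near near = refl
weight-product near mid  = refl
weight-product near far  = refl
weight-product mid  near = refl
weight-product mid  mid  = refl
weight-product mid  far  = refl
weight-product far  near = refl
weight-product far  mid  = refl
weight-product far  far  = refl

module Indices {n} {G : Graph n} (conn : Connected G) where

  d : Fin n → Fin n → ℕ
  d = dist conn

  geodesic : ∀ u v → Least (Walk G u v) (d u v)
  geodesic u v = proj₂ (shortest conn u v)

  open Metric {G = G} d geodesic

  V : List (Fin n)
  V = allFin n

  2*wiener : 2 * wiener conn ≡ ∑[ u ∈ V ] ∑[ v ∈ V ] d u v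
  2*wiener = 2*∑-pairs d d-sym d-refl

  ∑weight : ∀ u v → 2 * closer conn u v + equidistant conn u v ≡ ∑[ x ∈ V ] weight (σ (u , v) x)
  ∑weight u v = begin
    2 * closer conn u v + equidistant conn u v
      ≡⟨ cong₂ (λ i j → 2 * i + j) (length-filter-∑ _ V) (length-filter-∑ _ V) ⟩
    2 * (∑[ x ∈ V ] ⟦ d u x <? d v x ⟧) + ∑[ x ∈ V ] ⟦ d u x ≟ d v x ⟧
      ≡⟨ cong (λ i → i + ∑[ x ∈ V ] ⟦ d u x ≟ d v x ⟧) (∑-*ˡ 2 V _) ⟨
    (∑[ x ∈ V ] (2 * ⟦ d u x <? d v x ⟧)) + ∑[ x ∈ V ] ⟦ d u x ≟ d v x ⟧
      ≡⟨ ∑-+ V _ _ ⟨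
    ∑[ x ∈ V ] (2 * ⟦ d u x <? d v x ⟧ + ⟦ d u x ≟ d v x ⟧)
      ≡⟨ ∑-cong V (λ x → weight-side (d u x) (d v x)) ⟩
    ∑[ x ∈ V ] weight (σ (u , v) x) ∎
    where open ≡-Reasoning

  equidistant-comm : ∀ u v → equidistant conn u v ≡ equidistant conn v u
  equidistant-comm u v = trans (length-filter-∑ _ V) (trans (∑-cong V pointwise) (sym (length-filter-∑ _ V)))
    where
    pointwise : ∀ x → ⟦ d u x ≟ d v x ⟧ ≡ ⟦ d v x ≟ d u x ⟧
    pointwise x with d u x ≟ d v x
    ... | yes eq = sym (⟦⟧-yes (d v x ≟ d u x) (sym eq))
    ... | no  ne = sym (⟦⟧-no (d v x ≟ d u x) (ne ∘ sym))

  β : Fin n × Fin n → Fin n → Fin n → ℕ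
  β e x y = 2 * sep (σ e x) (σ e y) + hor (σ e x) (σ e y)

  -- The product is doubled and the indices of one copy are exchanged, which produces the
  -- symmetrised summand; the 2 is then cancelled.
  ∑weight-product : ∀ e →
    (∑[ x ∈ V ] weight (σ e x)) * (∑[ y ∈ V ] weight (opp (σ e y))) ≡ ∑[ x ∈ V ] ∑[ y ∈ V ] β e x y
  ∑weight-product e = *-cancelˡ-≡ Q R 2 (begin
    2 * Q
      ≡⟨ cong (λ k → Q + k) (+-identityʳ Q) ⟩
    Q + Q
      ≡⟨ cong₂ _+_ Q≡ (trans Q≡ (∑-swap V V W)) ⟩
    (∑[ x ∈ V ] ∑[ y ∈ V ] W x y) + (∑[ x ∈ V ] ∑[ y ∈ V ] W y x)
      ≡⟨ ∑-+ V _ _ ⟨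
    ∑[ x ∈ V ] ((∑[ y ∈ V ] W x y) + (∑[ y ∈ V ] W y x))
      ≡⟨ ∑-cong V (λ x → trans (sym (∑-+ V (W x) (λ y → W y x)))
           (trans (∑-cong V (λ y → weight-product (σ e x) (σ e y))) (∑-*ˡ 2 V (β e x)))) ⟩
    ∑[ x ∈ V ] (2 * (∑[ y ∈ V ] β e x y))
      ≡⟨ ∑-*ˡ 2 V _ ⟩
    2 * R ∎)
    where
    open ≡-Reasoning

    W : Fin n → Fin n → ℕ
    W x y = weight (σ e x) * weight (opp (σ e y))

    Q R : ℕ
    Q = (∑[ x ∈ V ] weight (σ e x)) * (∑[ y ∈ V ] weight (opp (σ e y)))
    R = ∑[ x ∈ V ] ∑[ y ∈ V ] β e x y

    Q≡ : Q ≡ ∑[ x ∈ V ] ∑[ y ∈ V ] W x y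
    Q≡ = ∑-prod V V _ _

  ∑β : ∀ x y → ∑[ e ∈ edges G ] β e x y ≡ 2 * s x y + z x y
  ∑β x y = trans (∑-+ (edges G) _ _) (cong (_+ z x y) (∑-*ˡ 2 (edges G) _))

  revisedSzeged≡ : revisedSzeged conn ≡ + (∑[ x ∈ V ] ∑[ y ∈ V ] (2 * s x y + z x y)) / 4
  revisedSzeged≡ = trans (sumℚ-/4 (edges G) _ (λ e → ∑[ x ∈ V ] ∑[ y ∈ V ] β e x y) term≡)
    (cong (λ k → + k / 4) (trans (∑-swap (edges G) V _)
      (∑-cong V λ x → trans (∑-swap (edges G) V _) (∑-cong V (∑β x)))))
    where
    term≡ : ∀ ((u , v) : Fin n × Fin n) →
      (+ closer conn u v / 1 ℚ.+ + equidistant conn u v / 2) ℚ.* (+ closer conn v u / 1 ℚ.+ + equidistant conn u v / 2)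
      ≡ + (∑[ x ∈ V ] ∑[ y ∈ V ] β (u , v) x y) / 4
    term≡ (u , v) = trans (half-product (closer conn u v) (closer conn v u) (equidistant conn u v))
      (cong (λ k → + k / 4) (trans (cong₂ _*_ (∑weight u v)
        (trans (cong (λ k → 2 * closer conn v u + k) (equidistant-comm u v))
          (trans (∑weight v u) (∑-cong V λ x → cong weight (σ-opp u v x)))))
        (∑weight-product (u , v))))

  module _ (¬bip : ¬ Bipartite G) where

    open LowerBound {G = G} d geodesic ¬bip using (δ; ∑δ; 2s+z≡)

    ∑[2s+z] : ∑[ x ∈ V ] ∑[ y ∈ V ] (2 * s x y + z x y) ≡ n * n + ∑δ + 4 * wiener conn
    ∑[2s+z] = begin
      ∑[ x ∈ V ] ∑[ y ∈ V ] (2 * s x y + z x y)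
        ≡⟨ ∑-cong V row ⟩
      ∑[ x ∈ V ] (n + 2 * D x + ∑ V (δ x))
        ≡⟨ trans (∑-+ V _ _) (cong (_+ ∑δ) (∑-+ V _ _)) ⟩
      ∑[ x ∈ V ] n + ∑[ x ∈ V ] (2 * D x) + ∑δ
        ≡⟨ cong₂ (λ i j → i + j + ∑δ) (trans (∑-const n V) (cong (_* n) (length-tabulate {n = n} id)))
             (trans (∑-*ˡ 2 V D) (cong (2 *_) (sym 2*wiener))) ⟩
      n * n + 2 * (2 * wiener conn) + ∑δ
        ≡⟨ solve 3 (λ a w t → a :+ con 2 :* (con 2 :* w) :+ t := a :+ t :+ con 4 :* w) refl (n * n) (wiener conn) ∑δ ⟩
      n * n + ∑δ + 4 * wiener conn ∎
      where
      open ≡-Reasoning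
      open ℕ-Solver.+-*-Solver

      D : Fin n → ℕ
      D x = ∑[ y ∈ V ] d x y

      row : ∀ x → ∑[ y ∈ V ] (2 * s x y + z x y) ≡ n + 2 * D x + ∑ V (δ x)
      row x = begin
        ∑[ y ∈ V ] (2 * s x y + z x y)              ≡⟨ ∑-cong V (2s+z≡ x) ⟩
        ∑[ y ∈ V ] (1 + 2 * d x y + δ x y)          ≡⟨ trans (∑-+ V _ _) (cong (_+ ∑ V (δ x)) (∑-+ V _ _)) ⟩
        ∑[ y ∈ V ] 1 + ∑[ y ∈ V ] (2 * d x y) + ∑ V (δ x)
          ≡⟨ cong₂ (λ i j → i + j + ∑ V (δ x))
               (trans (∑-const 1 V) (trans (*-identityʳ _) (length-tabulate {n = n} id))) (∑-*ˡ 2 V (d x)) ⟩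
        n + 2 * D x + ∑ V (δ x)                     ∎

    -- Both the inequality and the case of equality thereby become statements about the natural
    -- number `∑δ`.
    difference≡ : revisedSzeged conn - + wiener conn / 1 ≡ + (n * n + ∑δ) / 4
    difference≡ = trans (cong (λ q → q - + wiener conn / 1) (trans revisedSzeged≡ (cong (λ k → + k / 4) ∑[2s+z])))
                        (+/4-shift (n * n + ∑δ) (wiener conn))

theorem2p6 : ∀ (n : ℕ) → 4 ≤ n → (G : Graph n) (conn : Connected G) → ¬ Bipartite G →
    let difference = revisedSzeged conn - + wiener conn / 1
        bound      = (+ (n ℕ.^ 2 ℕ.+ 4 ℕ.* n) ℤ.- + 6) / 4
    in difference ≥ bound × (difference ≡ bound ⇔ IsTriangleWithTree G)
-- Matching `n` as 2 + m makes `n ∸ 2` reduce to the order of the tree and supplies the vertex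
-- `zero` from which the search for a minimal configuration starts.
theorem2p6 n@(suc (suc _)) 4≤n@(s≤s (s≤s _)) G conn ¬bip =
    subst₂ ℚ._≤_ (sym bound≡) (sym (difference≡ ¬bip)) (+/4-mono-≤ (m≤n+o⇒m∸n≤o _ 6 inequality))
  , mk⇔ (λ eq → ExtremalStructure.triangleWithTree d geodesic conn ¬bip (∑δ-tight zero 4≤n (tight eq))) attained
  where
  open Indices conn
  open LowerBound {G = G} d geodesic ¬bip

  N : ℕ
  N = n ℕ.^ 2 + 4 * n

  6≤N : 6 ≤ N
  6≤N = ≤-trans (≤-trans (m≤m+n 6 10) (*-monoʳ-≤ 4 4≤n)) (m≤n+m (4 * n) (n ℕ.^ 2))

  bound≡ : (+ N ℤ.- + 6) / 4 ≡ + (N ∸ 6) / 4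
  bound≡ = cong (_/ 4) (trans (ℤ.m-n≡m⊖n N 6) (ℤ.⊖-≥ 6≤N))

  n^2≡ : n ℕ.^ 2 ≡ n * n
  n^2≡ = cong (n *_) (*-identityʳ n)

  shuffle : 6 + (n * n + ∑δ) ≡ n * n + (6 + ∑δ)
  shuffle = solve 2 (λ a t → con 6 :+ (a :+ t) := a :+ (con 6 :+ t)) refl (n * n) ∑δ
    where open ℕ-Solver.+-*-Solver

  inequality : N ≤ 6 + (n * n + ∑δ)
  inequality = begin
    n ℕ.^ 2 + 4 * n      ≡⟨ cong (_+ 4 * n) n^2≡ ⟩
    n * n + 4 * n        ≤⟨ +-monoʳ-≤ (n * n) (∑δ-bound zero) ⟩
    n * n + (6 + ∑δ)     ≡⟨ shuffle ⟨
    6 + (n * n + ∑δ)     ∎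
    where open ≤-Reasoning

  tight : revisedSzeged conn - + wiener conn / 1 ≡ (+ N ℤ.- + 6) / 4 → 6 + ∑δ ≤ 4 * n
  tight eq = +-cancelˡ-≤ (n * n) _ _ (begin
    n * n + (6 + ∑δ)     ≡⟨ shuffle ⟨
    6 + (n * n + ∑δ)     ≡⟨ cong (λ k → 6 + k) (+/4-injective (trans (sym (difference≡ ¬bip)) (trans eq bound≡))) ⟩
    6 + (N ∸ 6)          ≡⟨ m+[n∸m]≡n 6≤N ⟩
    n ℕ.^ 2 + 4 * n      ≡⟨ cong (_+ 4 * n) n^2≡ ⟩
    n * n + 4 * n        ∎)
    where open ≤-Reasoning

  attained : IsTriangleWithTree G → revisedSzeged conn - + wiener conn / 1 ≡ (+ N ℤ.- + 6) / 4
  attained (T , (_ , acyclic) , union) = trans (difference≡ ¬bip) (trans (cong (λ k → + k / 4) n*n+∑δ≡) (sym bound≡))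
    where
    n*n+∑δ≡ : n * n + ∑δ ≡ N ∸ 6
    n*n+∑δ≡ = +-cancelˡ-≡ 6 _ _ (begin
      6 + (n * n + ∑δ)   ≡⟨ shuffle ⟩
      n * n + (6 + ∑δ)
        ≡⟨ cong (λ k → n * n + k) (≤-antisym (FromUnion.∑δ-attained d geodesic ¬bip acyclic union) (∑δ-bound zero)) ⟩
      n * n + 4 * n      ≡⟨ cong (_+ 4 * n) n^2≡ ⟨
      N                  ≡⟨ m+[n∸m]≡n 6≤N ⟨
      6 + (N ∸ 6)        ∎)
      where open ≡-Reasoning
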